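{- There exist constants $c'>1$ and $\Delta_0$ such that for all integers $\Delta\ge\Delta_0$ and $n\ge\Delta$ the following holds. There exist a bipartite digraph $D_0=(A\cup B,E)$ with $|A|=|B|\le n$ and maximum degree $\Delta$, all of whose edges are directed from $A$ to $B$, and a tournament $R$ on $\lfloor (c')^{\Delta}n\rfloor$ vertices, such that for any $A'\subseteq A$ and $B'\subseteq B$ the following hold. 1. If $|A'|,|B'|\ge 0.98|A|$, then there is no copy of $D_0[A'\cup B']$ in $R$. 2. If $|A'|,|B'|\ge 0.01|A|$, then $e_{D_0}(A',B')>0$.
   Context: A tournament is an orientation of the edges of a finite complete graph. The maximum degree of a digraph is the maximum degree of its underlying undirected graph. $D_0[A'\cup B']$ is the induced subdigraph on $A'\cup B'$. A copy of a digraph $D$ in $R$ is a (not necessarily induced) subdigraph of $R$ isomorphic to $D$. $e_{D_0}(A',B')$ denotes the number of pairs in $A'\times B'$ that are edges of $D_0$. -}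

module Defs where

open import Algebra.Definitions.RawSemiring using () renaming (_^_ to power)
open import Data.Bool.Base using (Bool; T; not; _∨_)
open import Data.Bool.Properties using (T?)
open import Data.Fin.Base using (Fin)
open import Data.Fin.Subset using (Subset; _∈_; _∪_; _∩_; ⊤; ⊥; ∣_∣)
open import Data.Fin.Subset.Properties using (_∈?_)
open import Data.List.Base using (allFin; cartesianProduct; filter; length; map)
open import Data.List.Extrema.Nat using (max)
open import Data.Nat.Base using (ℕ)
open import Data.Product.Base using (Σ-syntax; ∃; _×_; _,_; proj₁)
open import Data.Rational.Base using (ℚ; +-*-rawSemiring)
open import Data.Vec.Base using (tabulate)
open import Function.Bundles using (_↔_; _⇔_; Inverse)
open import Relation.Binary.PropositionalEquality.Core using (_≡_; _≢_)
open import Relation.Nullary.Decidable using (_×-dec_)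
open import Relation.Nullary.Negation using (¬_)

infixr 8 _^_

_^_ : ℚ → ℕ → ℚ
_^_ = power +-*-rawSemiring

record Digraph (V : Set) : Set where
  field
    edge     : V → V → Bool
    loopless : ∀ v → ¬ T (edge v v)

  Edge : V → V → Set
  Edge u v = T (edge u v)

open Digraph public

IsTournament : {V : Set} → Digraph V → Set
IsTournament D = ∀ u v → u ≢ v → edge D u v ≡ not (edge D v u)

⟦_⟧ : ∀ {N} → Subset N → Set
⟦ S ⟧ = ∃ λ v → v ∈ S

infix 9 _[_]

_[_] : ∀ {N} → Digraph (Fin N) → (S : Subset N) → Digraph ⟦ S ⟧
D [ S ] = record
  { edge     = λ u v → edge D (proj₁ u) (proj₁ v)
  ; loopless = λ v → loopless D (proj₁ v)
  }

IsSubdigraph : ∀ {N} {S : Subset N} → Digraph ⟦ S ⟧ → Digraph (Fin N) → Set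
IsSubdigraph H D = ∀ u v → Edge H u v → Edge D (proj₁ u) (proj₁ v)

infix 4 _≅_

_≅_ : {V W : Set} → Digraph V → Digraph W → Set
_≅_ {V} {W} D H =
  Σ[ f ∈ (V ↔ W) ] (∀ u v → Edge D u v ⇔ Edge H (Inverse.to f u) (Inverse.to f v))

Copy : {V : Set} {N : ℕ} → Digraph V → Digraph (Fin N) → Set
Copy {N = N} D R =
  Σ[ S ∈ Subset N ] Σ[ H ∈ Digraph ⟦ S ⟧ ] (IsSubdigraph H R × D ≅ H)

-- The degree in the underlying undirected graph: a pair of opposite edges
-- contributes a single neighbour.
degree : ∀ {N} → Digraph (Fin N) → Fin N → ℕ
degree D v = ∣ tabulate (λ u → edge D v u ∨ edge D u v) ∣

maxDegree : ∀ {N} → Digraph (Fin N) → ℕ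
maxDegree {N} D = max 0 (map (degree D) (allFin N))

record IsBipartiteFromTo {N : ℕ} (D : Digraph (Fin N)) (A B : Subset N) : Set where
  field
    cover    : A ∪ B ≡ ⊤
    disjoint : A ∩ B ≡ ⊥
    directed : ∀ u v → Edge D u v → u ∈ A × v ∈ B

edgeCount : ∀ {N} → Digraph (Fin N) → Subset N → Subset N → ℕ
edgeCount {N} D X Y =
  length (filter (λ (u , v) → (u ∈? X ×-dec v ∈? Y) ×-dec T? (edge D u v))
                 (cartesianProduct (allFin N) (allFin N)))

{-# OPTIONS --safe #-}
module Submission where

open import Defs
open import Algebra.Bundles using (CommutativeMonoid)
open import Data.Bool.Base using (Bool; true; false; _∧_; _∨_; _xor_; not; if_then_else_; T)
open import Data.Bool.Properties using (T?; ∨-zeroʳ; ∨-identityʳ; not-involutive)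
open import Data.Fin.Base using (Fin; zero; suc; toℕ; fromℕ<; _↑ˡ_; _↑ʳ_; splitAt; inject≤; combine; quotient)
import Data.Fin.Properties as Fin
open import Data.Fin.Subset as Subset using (Subset; _⊆_; _∪_; ∣_∣)
open import Data.Fin.Subset.Properties using (_∈?_; ⊆-antisym; ⊆⊤; ⊥⊆; x∈p∪q⁺; x∈p∩q⁻)
open import Data.List.Base using (List; []; _∷_; _++_; map; length; allFin; cartesianProduct; cartesianProductWith; filter; filterᵇ; mapMaybe)
open import Data.List.Extrema.Nat using (max≈v⁺)
open import Data.List.Membership.Propositional using (_∈_)
open import Data.List.Membership.Propositional.Properties using (∈-allFin; ∈-map⁺; ∈-map⁻; ∈-++⁺ˡ; ∈-++⁺ʳ; ∈-++⁻; ∈-filter⁺; ∈-filter⁻; ∈-cartesianProduct⁺; ∈-cartesianProduct⁻; ∈-cartesianProductWith⁺; ∈-length)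
open import Data.List.Properties using (length-++; length-map; length-tabulate; length-filter; map-tabulate; map-mapMaybe)
import Data.List.Relation.Unary.All as All
import Data.List.Relation.Unary.All.Properties as All
open import Data.List.Relation.Unary.Any using (here; there)
open import Data.Maybe.Base as Maybe using (Maybe; just; nothing; maybe′)
open import Data.Maybe.Properties using (just-injective)
open import Data.Nat.Base using (ℕ; zero; suc; _≤_; _<_; _+_; _*_; _/_; _%_; z≤n; s≤s; _<ᵇ_; NonZero; >-nonZero; >-nonZero⁻¹; _∸_) renaming (_^_ to _^ᴺ_)
open import Data.Nat.DivMod using (m≡m%n+[m/n]*n; m%n<n; m/n*n≤m; m≥n⇒m/n>0; m*n/n≡m; /-monoˡ-≤)
open import Data.Nat.Properties
open import Data.Nat.Tactic.RingSolver using (solve-∀)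
open import Data.Product.Base using (Σ-syntax; ∃; _×_; _,_; proj₁; proj₂)
open import Data.Sum.Base using (_⊎_; inj₁; inj₂)
open import Data.Vec.Base as Vec using (Vec; []; _∷_; lookup; tabulate)
open import Data.Vec.Properties using (lookup∘tabulate; lookup⇒[]=; []=⇒lookup)
open import Data.Vec.Properties.WithK using ([]=-irrelevant)
open import Function.Base using (_∘_; id)
open import Function.Bundles using (Inverse; Equivalence)
open import Relation.Binary.Definitions using (tri<; tri≈; tri>)
open import Relation.Binary.PropositionalEquality hiding ([_])
open import Relation.Nullary.Decidable using (yes; no; does; from-yes; dec-true; dec-false)
open import Relation.Nullary.Negation using (¬_; contradiction)
open import Relation.Unary using (Decidable)

-- Let k = 2^(4b) with b proportional to Δ.  A first-moment argument gives a k × k bit matrix g in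
-- which every t × t submatrix, t = O(log k), contains a positive proportion of each bit.  The
-- tournament R has k blocks of s ≈ n / t vertices; blocks i < j are joined as g i j prescribes.
--
-- A copy of a subgraph of D₀ maps its vertices to blocks, at most s from either side to the same
-- block, so by the density of g a positive proportion of the pairs in A × B are sent against the
-- orientation of R.  There are only (k + 1)^(2n) = 2^(O(bn)) ways of assigning blocks to vertices, so
-- O(bn) greedily chosen pairs hit every such assignment, and these pairs are the edges of D₀.
-- By Markov's inequality few vertices have large degree; edges at those are dropped.  Sending all of
-- A′ to one block and all of B′ to another turns the second property into an instance of the same
-- hitting property.

-- Δ may stay fixed while n grows, so a union bound over all maps into R, about (c′^Δ n)^(2n) of
-- them, would cost log n edges per vertex. Recording only the block of each image removes the log
-- n: an assignment costs O(b) bits per vertex, whatever n is, and O(b) edges per vertex pay for it.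
-- The number of blocks is exponential in b, hence in Δ, which makes R larger than D₀ by a factor
-- exponential in Δ. One hitting property thus covers every A′ and B′ and every set of dropped
-- vertices at once, and the edges can be chosen before it is known which of them the degree bound
-- removes. Two factors 4^b make up k: one pays for the growth c′^Δ ≤ 4^(b+1), the other for blocks
-- being smaller than n by a factor linear in b. Probability is replaced by sums of naturals: an
-- average below a bound yields a witness.

private
  variable
    A B C : Set
    k n : ℕ

-- Indicators and finite sums.

𝟙 : Bool → ℕ
𝟙 true  = 1
𝟙 false = 0

𝟙≤1 : ∀ b → 𝟙 b ≤ 1
𝟙≤1 true  = s≤s z≤n
𝟙≤1 false = z≤n

𝟙-∧ : ∀ b c → 𝟙 (b ∧ c) ≡ 𝟙 b * 𝟙 c
𝟙-∧ true  c = sym (+-identityʳ (𝟙 c))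
𝟙-∧ false c = refl

𝟙-∨-≤ : ∀ b c → 𝟙 (b ∨ c) ≤ 𝟙 b + 𝟙 c
𝟙-∨-≤ true  c = s≤s z≤n
𝟙-∨-≤ false c = ≤-refl

∑ : List A → (A → ℕ) → ℕ
∑ []       f = 0
∑ (x ∷ xs) f = f x + ∑ xs f

∑-cong : ∀ (xs : List A) {f g} → (∀ x → f x ≡ g x) → ∑ xs f ≡ ∑ xs g
∑-cong []       h = refl
∑-cong (x ∷ xs) h = cong₂ _+_ (h x) (∑-cong xs h)

∑-mono : ∀ (xs : List A) {f g} → (∀ x → f x ≤ g x) → ∑ xs f ≤ ∑ xs g
∑-mono []       h = z≤n
∑-mono (x ∷ xs) h = +-mono-≤ (h x) (∑-mono xs h)

∑-mono-∈ : ∀ (xs : List A) {f g} → (∀ {x} → x ∈ xs → f x ≤ g x) → ∑ xs f ≤ ∑ xs g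
∑-mono-∈ []       h = z≤n
∑-mono-∈ (x ∷ xs) h = +-mono-≤ (h (here refl)) (∑-mono-∈ xs (h ∘ there))

∑-+ : ∀ (xs : List A) {f g} → ∑ xs (λ x → f x + g x) ≡ ∑ xs f + ∑ xs g
∑-+ []       = refl
∑-+ (x ∷ xs) {f} {g} = trans (cong (f x + g x +_) (∑-+ xs)) (shuffle (f x) (g x) _ _)
  where
  shuffle : ∀ a b c d → a + b + (c + d) ≡ a + c + (b + d)
  shuffle = solve-∀

∑-*ˡ : ∀ (xs : List A) c {f} → ∑ xs (λ x → c * f x) ≡ c * ∑ xs f
∑-*ˡ []       c = sym (*-zeroʳ c)
∑-*ˡ (x ∷ xs) c {f} = trans (cong (c * f x +_) (∑-*ˡ xs c)) (sym (*-distribˡ-+ c (f x) _))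

∑-*ʳ : ∀ (xs : List A) c {f} → ∑ xs (λ x → f x * c) ≡ ∑ xs f * c
∑-*ʳ xs c {f} = trans (∑-cong xs (λ x → *-comm (f x) c)) (trans (∑-*ˡ xs c) (*-comm c _))

∑-const : ∀ (xs : List A) c → ∑ xs (λ _ → c) ≡ length xs * c
∑-const []       c = refl
∑-const (x ∷ xs) c = cong (c +_) (∑-const xs c)

∑-swap : ∀ (xs : List A) (ys : List B) {f : A → B → ℕ} →
         ∑ xs (λ x → ∑ ys (f x)) ≡ ∑ ys (λ y → ∑ xs (λ x → f x y))
∑-swap []       ys = sym (trans (∑-const ys 0) (*-zeroʳ (length ys)))
∑-swap (x ∷ xs) ys {f} = trans (cong (∑ ys (f x) +_) (∑-swap xs ys)) (sym (∑-+ ys))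

∑-++ : ∀ (xs ys : List A) {f} → ∑ (xs ++ ys) f ≡ ∑ xs f + ∑ ys f
∑-++ []       ys = refl
∑-++ (x ∷ xs) ys {f} = trans (cong (f x +_) (∑-++ xs ys)) (sym (+-assoc (f x) _ _))

∑-map : ∀ (g : A → B) (xs : List A) {f} → ∑ (map g xs) f ≡ ∑ xs (f ∘ g)
∑-map g []       = refl
∑-map g (x ∷ xs) {f} = cong (f (g x) +_) (∑-map g xs)

∑-cartesianProductWith : ∀ (g : A → B → C) xs ys {f} →
  ∑ (cartesianProductWith g xs ys) f ≡ ∑ xs (λ x → ∑ ys (λ y → f (g x y)))
∑-cartesianProductWith g []       ys = refl
∑-cartesianProductWith g (x ∷ xs) ys =
  trans (∑-++ (map (g x) ys) _) (cong₂ _+_ (∑-map (g x) ys) (∑-cartesianProductWith g xs ys))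

∑-mapMaybe : ∀ (g : A → Maybe B) xs {f} → ∑ (mapMaybe g xs) f ≡ ∑ xs (λ x → maybe′ f 0 (g x))
∑-mapMaybe g []       = refl
∑-mapMaybe g (x ∷ xs) {f} with g x
... | just y  = cong (f y +_) (∑-mapMaybe g xs)
... | nothing = ∑-mapMaybe g xs

∑-filter : ∀ {P : A → Set} (P? : Decidable P) xs {f} →
           ∑ (filter P? xs) f ≡ ∑ xs (λ x → 𝟙 (does (P? x)) * f x)
∑-filter P? []       = refl
∑-filter P? (x ∷ xs) {f} with does (P? x)
... | true  = cong₂ _+_ (sym (+-identityʳ (f x))) (∑-filter P? xs)
... | false = ∑-filter P? xs

length-∑ : ∀ (xs : List A) → length xs ≡ ∑ xs (λ _ → 1)
length-∑ xs = sym (trans (∑-const xs 1) (*-identityʳ _))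

≤-∑ : ∀ {xs : List A} {x} f → x ∈ xs → f x ≤ ∑ xs f
≤-∑ f (here refl) = m≤m+n _ _
≤-∑ f (there x∈)  = ≤-trans (≤-∑ f x∈) (m≤n+m _ _)

∑-<⇒∃ : ∀ (xs : List A) {f g} → ∑ xs f < ∑ xs g → ∃ λ x → f x < g x
∑-<⇒∃ (x ∷ xs) {f} {g} lt with f x <? g x
... | yes p = x , p
... | no ¬p = ∑-<⇒∃ xs (+-cancelˡ-< (f x) _ _ (<-≤-trans lt (+-monoˡ-≤ _ (≮⇒≥ ¬p))))

∑-suc : (f : Fin (suc n) → ℕ) → ∑ (allFin (suc n)) f ≡ f zero + ∑ (allFin n) (f ∘ suc)
∑-suc {n} f = cong (f zero +_)
  (trans (cong (λ l → ∑ l f) (sym (map-tabulate id suc))) (∑-map suc (allFin n)))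

∑-allFin-const : ∀ n c → ∑ (allFin n) (λ _ → c) ≡ n * c
∑-allFin-const n c = trans (∑-const (allFin n) c) (cong (_* c) (length-tabulate {n = n} id))

∣∣≡∑ : (X : Subset n) → ∣ X ∣ ≡ ∑ (allFin n) (λ i → 𝟙 (lookup X i))
∣∣≡∑ []          = refl
∣∣≡∑ (true  ∷ X) = trans (cong suc (∣∣≡∑ X)) (sym (∑-suc (λ i → 𝟙 (lookup (true ∷ X) i))))
∣∣≡∑ (false ∷ X) = trans (∣∣≡∑ X) (sym (∑-suc (λ i → 𝟙 (lookup (false ∷ X) i))))

-- Products, sums over all vectors, greedy covering.

∏ : (Fin n → ℕ) → ℕ
∏ {zero}  h = 1
∏ {suc n} h = h zero * ∏ (h ∘ suc)

∏-cong : {f g : Fin n → ℕ} → (∀ i → f i ≡ g i) → ∏ f ≡ ∏ g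
∏-cong {zero}  h = refl
∏-cong {suc n} h = cong₂ _*_ (h zero) (∏-cong (h ∘ suc))

∏-^ : ∀ x (f : Fin n → ℕ) → ∏ (λ i → x ^ᴺ f i) ≡ x ^ᴺ ∑ (allFin n) f
∏-^ {zero}  x f = refl
∏-^ {suc n} x f = begin
  x ^ᴺ f zero * ∏ (λ i → x ^ᴺ f (suc i))      ≡⟨ cong (x ^ᴺ f zero *_) (∏-^ x (f ∘ suc)) ⟩
  x ^ᴺ f zero * x ^ᴺ ∑ (allFin n) (f ∘ suc)   ≡⟨ ^-distribˡ-+-* x (f zero) _ ⟨
  x ^ᴺ (f zero + ∑ (allFin n) (f ∘ suc))     ≡⟨ cong (x ^ᴺ_) (∑-suc f) ⟨
  x ^ᴺ ∑ (allFin (suc n)) f                  ∎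
  where open ≡-Reasoning

allVecs : List A → ∀ m → List (Vec A m)
allVecs us zero    = [] ∷ []
allVecs us (suc m) = cartesianProductWith _∷_ us (allVecs us m)

-- Distributivity. With vectors as sample points this is independence of the coordinates; for a bit
-- matrix it is used first over the rows, then over the entries of a row.
∑-allVecs : ∀ (us : List A) m (h : Fin m → A → ℕ) →
  ∑ (allVecs us m) (λ v → ∏ (λ j → h j (lookup v j))) ≡ ∏ (λ j → ∑ us (h j))
∑-allVecs us zero    h = refl
∑-allVecs us (suc m) h = begin
  ∑ (allVecs us (suc m)) (λ v → ∏ (λ j → h j (lookup v j)))
    ≡⟨ ∑-cartesianProductWith _∷_ us (allVecs us m) ⟩
  ∑ us (λ u → ∑ (allVecs us m) (λ v → h zero u * ∏ (λ j → h (suc j) (lookup v j))))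
    ≡⟨ ∑-cong us (λ u → ∑-*ˡ (allVecs us m) (h zero u)) ⟩
  ∑ us (λ u → h zero u * ∑ (allVecs us m) (λ v → ∏ (λ j → h (suc j) (lookup v j))))
    ≡⟨ ∑-*ʳ us _ ⟩
  ∑ us (h zero) * ∑ (allVecs us m) (λ v → ∏ (λ j → h (suc j) (lookup v j)))
    ≡⟨ cong (∑ us (h zero) *_) (∑-allVecs us m (h ∘ suc)) ⟩
  ∏ (λ j → ∑ us (h j)) ∎
  where open ≡-Reasoning

length-allVecs : ∀ (us : List A) m → length (allVecs us m) ≡ length us ^ᴺ m
length-allVecs us zero    = refl
length-allVecs us (suc m) = begin
  length (allVecs us (suc m))                      ≡⟨ length-∑ (allVecs us (suc m)) ⟩
  ∑ (allVecs us (suc m)) (λ _ → 1)                 ≡⟨ ∑-cartesianProductWith _∷_ us (allVecs us m) ⟩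
  ∑ us (λ _ → ∑ (allVecs us m) (λ _ → 1))          ≡⟨ ∑-const us _ ⟩
  length us * ∑ (allVecs us m) (λ _ → 1)           ≡⟨ cong (length us *_) (length-∑ (allVecs us m)) ⟨
  length us * length (allVecs us m)                ≡⟨ cong (length us *_) (length-allVecs us m) ⟩
  length us * length us ^ᴺ m                        ∎
  where open ≡-Reasoning

length-cartesianProduct : ∀ (xs : List A) (ys : List B) →
  length (cartesianProduct xs ys) ≡ length xs * length ys
length-cartesianProduct []       ys = refl
length-cartesianProduct (x ∷ xs) ys = trans (length-++ (map (x ,_) ys))
  (cong₂ _+_ (length-map (x ,_) ys) (length-cartesianProduct xs ys))

-- Some `u` hits at least the average share 1/(D+1) of the remaining tests, so each choice shrinks
-- their number by a factor D/(D+1), and fewer than one is left after `m` choices. Denominators are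
-- cleared so that the bound on `length ts` is itself the invariant of the induction.
greedy-cover : ∀ (us : List A) (hit : B → A → Bool) D m (ts : List B) → 0 < length us →
  (∀ {t} → t ∈ ts → length us ≤ suc D * ∑ us (λ u → 𝟙 (hit t u))) →
  length ts * D ^ᴺ m < suc D ^ᴺ m →
  ∃ λ es → length es ≡ m × (∀ {t} → t ∈ ts → ∃ λ u → u ∈ es × hit t u ≡ true)
greedy-cover us hit D zero    []       _   _     _  = [] , refl , λ ()
greedy-cover us hit D zero    (_ ∷ _)  _   _     (s≤s ())
greedy-cover {A = A} {B = B} us hit D (suc m) ts us≢[] dense lt =
  -- The added 1 turns the strict inequality that averaging yields into a weak one; `0 < length us`
  -- pays for it.
  let u , u-best = ∑-<⇒∃ us {f = λ _ → length ts} {g = λ u → suc (suc D * ∑ ts (λ t → 𝟙 (hit t u)))} average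
      es , len , covers = greedy-cover us hit D m (rest u) us≢[] (dense ∘ proj₁ ∘ ∈-filter⁻ (missed u)) (shrink u (≤-pred u-best))
  in u ∷ es , cong suc len , case-hit u es covers
  where
  missed : ∀ u t → _
  missed u t = T? (not (hit t u))

  rest : A → List B
  rest u = filter (missed u) ts

  case-hit : ∀ u es → (∀ {t} → t ∈ rest u → ∃ λ u′ → u′ ∈ es × hit t u′ ≡ true) →
             ∀ {t} → t ∈ ts → ∃ λ u′ → u′ ∈ u ∷ es × hit t u′ ≡ true
  case-hit u es covers {t} t∈ with hit t u in eq
  ... | true  = u , here refl , eq
  ... | false with u′ , u′∈ , h ← covers (∈-filter⁺ (missed u) t∈ (subst (T ∘ not) (sym eq) _))
              = u′ , there u′∈ , h

  average : ∑ us (λ _ → length ts) < ∑ us (λ u → suc (suc D * ∑ ts (λ t → 𝟙 (hit t u))))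
  average = begin-strict
    ∑ us (λ _ → length ts)                                       ≡⟨ ∑-const us _ ⟩
    length us * length ts                                        ≡⟨ *-comm (length us) _ ⟩
    length ts * length us                                        ≡⟨ ∑-const ts _ ⟨
    ∑ ts (λ _ → length us)                                       ≤⟨ ∑-mono-∈ ts dense ⟩
    ∑ ts (λ t → suc D * ∑ us (λ u → 𝟙 (hit t u)))                ≡⟨ ∑-*ˡ ts (suc D) ⟩
    suc D * ∑ ts (λ t → ∑ us (λ u → 𝟙 (hit t u)))                ≡⟨ cong (suc D *_) (∑-swap ts us) ⟩
    suc D * ∑ us (λ u → ∑ ts (λ t → 𝟙 (hit t u)))                ≡⟨ ∑-*ˡ us (suc D) ⟨
    ∑ us (λ u → suc D * ∑ ts (λ t → 𝟙 (hit t u)))                <⟨ m<n+m _ us≢[] ⟩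
    length us + ∑ us (λ u → suc D * ∑ ts (λ t → 𝟙 (hit t u)))    ≡⟨ cong (_+ ∑ us (λ u → suc D * ∑ ts (λ t → 𝟙 (hit t u)))) (length-∑ us) ⟩
    ∑ us (λ _ → 1) + ∑ us (λ u → suc D * ∑ ts (λ t → 𝟙 (hit t u))) ≡⟨ ∑-+ us ⟨
    ∑ us (λ u → suc (suc D * ∑ ts (λ t → 𝟙 (hit t u))))          ∎
    where open ≤-Reasoning

  split : ∀ u → length (rest u) + ∑ ts (λ t → 𝟙 (hit t u)) ≡ length ts
  split u = begin
    length (rest u) + ∑ ts (λ t → 𝟙 (hit t u))
      ≡⟨ cong (_+ ∑ ts (λ t → 𝟙 (hit t u))) (trans (length-∑ (rest u)) (∑-filter (missed u) ts)) ⟩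
    ∑ ts (λ t → 𝟙 (not (hit t u)) * 1) + ∑ ts (λ t → 𝟙 (hit t u))
      ≡⟨ ∑-+ ts ⟨
    ∑ ts (λ t → 𝟙 (not (hit t u)) * 1 + 𝟙 (hit t u))
      ≡⟨ ∑-cong ts (λ t → either (hit t u)) ⟩
    ∑ ts (λ _ → 1)
      ≡⟨ length-∑ ts ⟨
    length ts ∎
    where
    open ≡-Reasoning
    either : ∀ b → 𝟙 (not b) * 1 + 𝟙 b ≡ 1
    either true  = refl
    either false = refl

  shrink : ∀ u → length ts ≤ suc D * ∑ ts (λ t → 𝟙 (hit t u)) → length (rest u) * D ^ᴺ m < suc D ^ᴺ m
  shrink u best = *-cancelˡ-< (suc D) _ _ (begin-strict
    suc D * (length (rest u) * D ^ᴺ m)  ≡⟨ *-assoc (suc D) (length (rest u)) _ ⟨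
    suc D * length (rest u) * D ^ᴺ m    ≤⟨ *-monoˡ-≤ (D ^ᴺ m) fewer ⟩
    length ts * D * D ^ᴺ m              ≡⟨ *-assoc (length ts) D _ ⟩
    length ts * D ^ᴺ suc m              <⟨ lt ⟩
    suc D ^ᴺ suc m                      ∎)
    where
    open ≤-Reasoning
    h = ∑ ts (λ t → 𝟙 (hit t u))
    fewer : suc D * length (rest u) ≤ length ts * D
    fewer = +-cancelʳ-≤ (length ts) _ _ (begin
      suc D * length (rest u) + length ts  ≤⟨ +-monoʳ-≤ _ best ⟩
      suc D * length (rest u) + suc D * h  ≡⟨ *-distribˡ-+ (suc D) (length (rest u)) h ⟨
      suc D * (length (rest u) + h)        ≡⟨ cong (suc D *_) (split u) ⟩
      suc D * length ts                    ≡⟨ expand D (length ts) ⟩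
      length ts * D + length ts            ∎)
      where
      expand : ∀ x y → suc x * y ≡ y * x + y
      expand = solve-∀

-- Bit matrices without unbalanced t × t submatrices.

combinations : ∀ k → ℕ → List (Subset k)
combinations zero    zero    = [] ∷ []
combinations zero    (suc t) = []
combinations (suc k) zero    = map (false ∷_) (combinations k zero)
combinations (suc k) (suc t) = map (true ∷_) (combinations k t) ++ map (false ∷_) (combinations k (suc t))

∈-combinations : (X : Subset k) → X ∈ combinations k ∣ X ∣
∈-combinations []          = here refl
∈-combinations (true  ∷ X) = ∈-++⁺ˡ (∈-map⁺ (true ∷_) (∈-combinations X))
∈-combinations {suc k} (false ∷ X) with ∣ X ∣ | ∈-combinations X
... | zero  | X∈ = ∈-map⁺ (false ∷_) X∈
... | suc t | X∈ = ∈-++⁺ʳ (map (true ∷_) (combinations k t)) (∈-map⁺ (false ∷_) X∈)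

combinations-size : ∀ k t {X} → X ∈ combinations k t → ∣ X ∣ ≡ t
combinations-size zero    zero    (here refl) = refl
combinations-size (suc k) zero    X∈ with _ , X′∈ , refl ← ∈-map⁻ (false ∷_) X∈ = combinations-size k zero X′∈
combinations-size (suc k) (suc t) X∈ with ∈-++⁻ (map (true ∷_) (combinations k t)) X∈
... | inj₁ p with _ , X′∈ , refl ← ∈-map⁻ (true ∷_) p = cong suc (combinations-size k t X′∈)
... | inj₂ p with _ , X′∈ , refl ← ∈-map⁻ (false ∷_) p = combinations-size k (suc t) X′∈

length-combinations : ∀ k t → length (combinations k t) ≤ k ^ᴺ t
length-combinations zero    zero    = ≤-refl
length-combinations zero    (suc t) = z≤n
length-combinations (suc k) zero    = ≤-trans (≤-reflexive (length-map _ (combinations k 0))) (length-combinations k 0)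
length-combinations (suc k) (suc t) = begin
  length (combinations (suc k) (suc t))
    ≡⟨ length-++ (map (true ∷_) (combinations k t)) ⟩
  length (map (true ∷_) (combinations k t)) + length (map (false ∷_) (combinations k (suc t)))
    ≡⟨ cong₂ _+_ (length-map _ (combinations k t)) (length-map _ (combinations k (suc t))) ⟩
  length (combinations k t) + length (combinations k (suc t))
    ≤⟨ +-mono-≤ (length-combinations k t) (length-combinations k (suc t)) ⟩
  suc k * k ^ᴺ t
    ≤⟨ *-monoʳ-≤ (suc k) (^-monoˡ-≤ t (n≤1+n k)) ⟩
  suc k * suc k ^ᴺ t ∎
  where open ≤-Reasoning

∑∑ : (Fin k → Fin k → ℕ) → ℕ
∑∑ {k} f = ∑ (allFin k) λ i → ∑ (allFin k) λ j → f i j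

∑∑-cong : {f g : Fin k → Fin k → ℕ} → (∀ i j → f i j ≡ g i j) → ∑∑ f ≡ ∑∑ g
∑∑-cong {k} h = ∑-cong (allFin k) λ i → ∑-cong (allFin k) (h i)

∑∑-+ : (f g : Fin k → Fin k → ℕ) → ∑∑ (λ i j → f i j + g i j) ≡ ∑∑ f + ∑∑ g
∑∑-+ {k} f g = trans (∑-cong (allFin k) λ i → ∑-+ (allFin k)) (∑-+ (allFin k))

∏∏-^ : ∀ x (f : Fin k → Fin k → ℕ) → ∏ (λ i → ∏ λ j → x ^ᴺ f i j) ≡ x ^ᴺ ∑∑ f
∏∏-^ {k} x f = trans (∏-cong λ i → ∏-^ x (f i)) (∏-^ x (λ i → ∑ (allFin k) (f i)))

∑∑-× : (X Y : Subset k) → ∑∑ (λ i j → 𝟙 (lookup X i ∧ lookup Y j)) ≡ ∣ X ∣ * ∣ Y ∣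
∑∑-× {k} X Y = begin
  ∑∑ (λ i j → 𝟙 (lookup X i ∧ lookup Y j))
    ≡⟨ ∑∑-cong (λ i j → 𝟙-∧ (lookup X i) (lookup Y j)) ⟩
  ∑∑ (λ i j → 𝟙 (lookup X i) * 𝟙 (lookup Y j))
    ≡⟨ ∑-cong (allFin k) (λ i → ∑-*ˡ (allFin k) (𝟙 (lookup X i))) ⟩
  ∑ (allFin k) (λ i → 𝟙 (lookup X i) * ∑ (allFin k) (λ j → 𝟙 (lookup Y j)))
    ≡⟨ ∑-*ʳ (allFin k) _ ⟩
  ∑ (allFin k) (λ i → 𝟙 (lookup X i)) * ∑ (allFin k) (λ j → 𝟙 (lookup Y j))
    ≡⟨ cong₂ _*_ (∣∣≡∑ X) (∣∣≡∑ Y) ⟨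
  ∣ X ∣ * ∣ Y ∣ ∎
  where open ≡-Reasoning

-- First moment, over all k × k bit matrices g, of 3 to the number of entries of X × Y equal to c.
balanced-matrix : ∀ k t C → 2 * (k ^ᴺ t * k ^ᴺ t) * 2 ^ᴺ (t * t) < 3 ^ᴺ C →
  ∃ λ (g : Fin k → Fin k → Bool) → ∀ c (X Y : Subset k) → ∣ X ∣ ≡ t → ∣ Y ∣ ≡ t →
    ∑∑ (λ i j → 𝟙 ((lookup X i ∧ lookup Y j) ∧ not (c xor g i j))) < C
balanced-matrix k t C bound =
  let G , small = ∑-<⇒∃ matrices {f = λ G → ∑ tests (weight G)} {g = λ _ → 3 ^ᴺ C} average
  in entry G , few G small
  where
  bools = true ∷ false ∷ []
  matrices = allVecs (allVecs bools k) k
  tests = cartesianProduct bools (cartesianProduct (combinations k t) (combinations k t))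

  entry : Vec (Vec Bool k) k → Fin k → Fin k → Bool
  entry G i j = lookup (lookup G i) j

  mark : Bool × Subset k × Subset k → Fin k → Fin k → Bool → ℕ
  mark (c , X , Y) i j b = 𝟙 ((lookup X i ∧ lookup Y j) ∧ not (c xor b))

  weight : Vec (Vec Bool k) k → Bool × Subset k × Subset k → ℕ
  weight G τ = ∏ λ i → ∏ λ j → 3 ^ᴺ mark τ i j (entry G i j)

  weight-^ : ∀ G τ → weight G τ ≡ 3 ^ᴺ ∑∑ (λ i j → mark τ i j (entry G i j))
  weight-^ G τ = ∏∏-^ 3 (λ i j → mark τ i j (entry G i j))

  tests-∈ : ∀ c (X Y : Subset k) → ∣ X ∣ ≡ t → ∣ Y ∣ ≡ t → (c , X , Y) ∈ tests
  tests-∈ c X Y p q = ∈-cartesianProduct⁺ (c∈ c) (∈-cartesianProduct⁺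
    (subst (λ z → X ∈ combinations k z) p (∈-combinations X))
    (subst (λ z → Y ∈ combinations k z) q (∈-combinations Y)))
    where
    c∈ : ∀ c → c ∈ bools
    c∈ true  = here refl
    c∈ false = there (here refl)

  few : ∀ G → ∑ tests (weight G) < 3 ^ᴺ C → ∀ c (X Y : Subset k) → ∣ X ∣ ≡ t → ∣ Y ∣ ≡ t →
    ∑∑ (λ i j → mark (c , X , Y) i j (entry G i j)) < C
  few G small c X Y p q = ≰⇒> λ C≤ → <-irrefl refl (begin-strict
    3 ^ᴺ C                                                   ≤⟨ ^-monoʳ-≤ 3 C≤ ⟩
    3 ^ᴺ ∑∑ (λ i j → mark (c , X , Y) i j (entry G i j))     ≡⟨ weight-^ G (c , X , Y) ⟨
    weight G (c , X , Y)                                    ≤⟨ ≤-∑ (weight G) (tests-∈ c X Y p q) ⟩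
    ∑ tests (weight G)                                      <⟨ small ⟩
    3 ^ᴺ C                                                   ∎)
    where open ≤-Reasoning

  -- A cell inside the tested submatrix averages (3 + 1) / 2 = 2 and any other cell 1, whence a
  -- factor 2^(t²) per test. The value x = 3 minimises (1 + x) / (2 x^(3/4)), so 3 is the best base
  -- for excluding a proportion 3/4.
  entry-sum : ∀ x c → ∑ bools (λ b → 3 ^ᴺ 𝟙 (x ∧ not (c xor b))) ≡ 2 ^ᴺ (1 + 𝟙 x)
  entry-sum true  true  = refl
  entry-sum true  false = refl
  entry-sum false c     = refl

  total : ∀ c (X Y : Subset k) → ∑ matrices (λ G → weight G (c , X , Y)) ≡ 2 ^ᴺ (k * k + ∣ X ∣ * ∣ Y ∣)
  total c X Y = begin
    ∑ matrices (λ G → weight G (c , X , Y))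
      ≡⟨ ∑-allVecs (allVecs bools k) k (λ i r → ∏ λ j → 3 ^ᴺ mark (c , X , Y) i j (lookup r j)) ⟩
    ∏ (λ i → ∑ (allVecs bools k) (λ r → ∏ λ j → 3 ^ᴺ mark (c , X , Y) i j (lookup r j)))
      ≡⟨ ∏-cong (λ i → ∑-allVecs bools k (λ j b → 3 ^ᴺ mark (c , X , Y) i j b)) ⟩
    ∏ (λ i → ∏ λ j → ∑ bools (λ b → 3 ^ᴺ mark (c , X , Y) i j b))
      ≡⟨ ∏-cong (λ i → ∏-cong λ j → entry-sum (lookup X i ∧ lookup Y j) c) ⟩
    ∏ (λ i → ∏ λ j → 2 ^ᴺ (1 + 𝟙 (lookup X i ∧ lookup Y j)))
      ≡⟨ ∏∏-^ 2 (λ i j → 1 + 𝟙 (lookup X i ∧ lookup Y j)) ⟩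
    2 ^ᴺ ∑∑ (λ i j → 1 + 𝟙 (lookup X i ∧ lookup Y j))
      ≡⟨ cong (2 ^ᴺ_) (∑∑-+ (λ _ _ → 1) (λ i j → 𝟙 (lookup X i ∧ lookup Y j))) ⟩
    2 ^ᴺ (∑∑ {k} (λ _ _ → 1) + ∑∑ (λ i j → 𝟙 (lookup X i ∧ lookup Y j)))
      ≡⟨ cong (2 ^ᴺ_) (cong₂ _+_ square (∑∑-× X Y)) ⟩
    2 ^ᴺ (k * k + ∣ X ∣ * ∣ Y ∣) ∎
    where
    open ≡-Reasoning
    square : ∑∑ {k} (λ _ _ → 1) ≡ k * k
    square = trans (∑-allFin-const k _) (cong (k *_) (trans (∑-allFin-const k 1) (*-identityʳ k)))

  count : length matrices ≡ 2 ^ᴺ (k * k)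
  count = trans (length-allVecs (allVecs bools k) k) (trans (cong (_^ᴺ k) (length-allVecs bools k)) (^-*-assoc 2 k k))

  test-total : ∀ {τ} → τ ∈ tests → ∑ matrices (λ G → weight G τ) ≤ 2 ^ᴺ (k * k + t * t)
  test-total {c , X , Y} τ∈ = ≤-reflexive (trans (total c X Y) (cong₂ (λ p q → 2 ^ᴺ (k * k + p * q))
    (combinations-size k t (proj₁ XY∈)) (combinations-size k t (proj₂ XY∈))))
    where
    XY∈ = ∈-cartesianProduct⁻ (combinations k t) (combinations k t)
            (proj₂ (∈-cartesianProduct⁻ bools (cartesianProduct (combinations k t) (combinations k t)) τ∈))

  length-tests : length tests ≤ 2 * (k ^ᴺ t * k ^ᴺ t)
  length-tests = begin
    length tests
      ≡⟨ length-cartesianProduct bools (cartesianProduct (combinations k t) (combinations k t)) ⟩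
    2 * length (cartesianProduct (combinations k t) (combinations k t))
      ≡⟨ cong (2 *_) (length-cartesianProduct (combinations k t) (combinations k t)) ⟩
    2 * (length (combinations k t) * length (combinations k t))
      ≤⟨ *-monoʳ-≤ 2 (*-mono-≤ (length-combinations k t) (length-combinations k t)) ⟩
    2 * (k ^ᴺ t * k ^ᴺ t) ∎
    where open ≤-Reasoning

  average : ∑ matrices (λ G → ∑ tests (weight G)) < ∑ matrices (λ _ → 3 ^ᴺ C)
  average = begin-strict
    ∑ matrices (λ G → ∑ tests (weight G))
      ≡⟨ ∑-swap matrices tests ⟩
    ∑ tests (λ τ → ∑ matrices (λ G → weight G τ))
      ≤⟨ ∑-mono-∈ tests test-total ⟩
    ∑ tests (λ _ → 2 ^ᴺ (k * k + t * t))
      ≡⟨ ∑-const tests _ ⟩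
    length tests * 2 ^ᴺ (k * k + t * t)
      ≤⟨ *-monoˡ-≤ _ length-tests ⟩
    2 * (k ^ᴺ t * k ^ᴺ t) * 2 ^ᴺ (k * k + t * t)
      ≡⟨ cong (2 * (k ^ᴺ t * k ^ᴺ t) *_) (^-distribˡ-+-* 2 (k * k) (t * t)) ⟩
    2 * (k ^ᴺ t * k ^ᴺ t) * (2 ^ᴺ (k * k) * 2 ^ᴺ (t * t))
      ≡⟨ rearrange (2 * (k ^ᴺ t * k ^ᴺ t)) (2 ^ᴺ (k * k)) (2 ^ᴺ (t * t)) ⟩
    2 ^ᴺ (k * k) * (2 * (k ^ᴺ t * k ^ᴺ t) * 2 ^ᴺ (t * t))
      <⟨ *-monoʳ-< (2 ^ᴺ (k * k)) {{m^n≢0 2 (k * k)}} bound ⟩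
    2 ^ᴺ (k * k) * 3 ^ᴺ C
      ≡⟨ cong (_* 3 ^ᴺ C) count ⟨
    length matrices * 3 ^ᴺ C
      ≡⟨ ∑-const matrices _ ⟨
    ∑ matrices (λ _ → 3 ^ᴺ C) ∎
    where
    open ≤-Reasoning
    rearrange : ∀ x y z → x * (y * z) ≡ y * (x * z)
    rearrange = solve-∀

-- A product of indicators rather than `𝟙` of a conjunction, so that the row and the column factor
-- come out of the sums.
Dense : ℕ → (Fin k → Fin k → Bool) → Set
Dense {k} t H = ∀ (X Y : Subset k) → ∣ X ∣ ≡ t → ∣ Y ∣ ≡ t →
  t * t ≤ 4 * ∑∑ (λ i j → 𝟙 (lookup X i) * (𝟙 (lookup Y j) * 𝟙 (H i j)))

-- Fewer than 108 a², that is 3/4 of the t² = 144 a² cells, carry any one bit, so more than a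
-- quarter carry the other. The 2 k^(2t) tests number 2^(1 + 24 a²) and the first moment is 2^(1 +
-- 168 a²). This is below 3^(108 a²), since 2^19 ≤ 3^12 gives 2^(171 a²) ≤ 3^(108 a²).
dense-matrix : ∀ a → 1 ≤ a → ∃ λ (g : Fin (2 ^ᴺ a) → Fin (2 ^ᴺ a) → Bool) → ∀ c → Dense (12 * a) (λ i j → c xor g i j)
dense-matrix a 1≤a = let g , few = balanced-matrix (2 ^ᴺ a) (12 * a) (108 * (a * a)) bound
                     in g , λ c X Y p q → many g c X Y p q (few c X Y p q)
  where
  1≤a² : 1 ≤ a * a
  1≤a² = *-mono-≤ 1≤a 1≤a

  bound : 2 * ((2 ^ᴺ a) ^ᴺ (12 * a) * (2 ^ᴺ a) ^ᴺ (12 * a)) * 2 ^ᴺ (12 * a * (12 * a)) < 3 ^ᴺ (108 * (a * a))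
  bound = begin-strict
    2 * ((2 ^ᴺ a) ^ᴺ (12 * a) * (2 ^ᴺ a) ^ᴺ (12 * a)) * 2 ^ᴺ (12 * a * (12 * a))
      ≡⟨ cong (λ z → 2 * (z * z) * 2 ^ᴺ (12 * a * (12 * a))) (^-*-assoc 2 a (12 * a)) ⟩
    2 * (2 ^ᴺ (a * (12 * a)) * 2 ^ᴺ (a * (12 * a))) * 2 ^ᴺ (12 * a * (12 * a))
      ≡⟨ cong (λ z → 2 * z * 2 ^ᴺ (12 * a * (12 * a))) (^-distribˡ-+-* 2 (a * (12 * a)) _) ⟨
    2 ^ᴺ suc (a * (12 * a) + a * (12 * a)) * 2 ^ᴺ (12 * a * (12 * a))
      ≡⟨ ^-distribˡ-+-* 2 (suc (a * (12 * a) + a * (12 * a))) _ ⟨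
    2 ^ᴺ (suc (a * (12 * a) + a * (12 * a)) + 12 * a * (12 * a))
      ≡⟨ cong (2 ^ᴺ_) (exponent a) ⟩
    2 ^ᴺ (1 + 168 * (a * a))
      <⟨ ^-monoʳ-< 2 (s≤s (s≤s z≤n)) (+-monoˡ-< (168 * (a * a)) (≤-trans (s≤s (s≤s z≤n)) (*-monoʳ-≤ 3 1≤a²))) ⟩
    2 ^ᴺ (3 * (a * a) + 168 * (a * a))
      ≡⟨ cong (2 ^ᴺ_) (exponent′ (a * a)) ⟩
    2 ^ᴺ (19 * (9 * (a * a)))
      ≡⟨ ^-*-assoc 2 19 (9 * (a * a)) ⟨
    (2 ^ᴺ 19) ^ᴺ (9 * (a * a))
      ≤⟨ ^-monoˡ-≤ (9 * (a * a)) (from-yes (2 ^ᴺ 19 ≤? 3 ^ᴺ 12)) ⟩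
    (3 ^ᴺ 12) ^ᴺ (9 * (a * a))
      ≡⟨ ^-*-assoc 3 12 (9 * (a * a)) ⟩
    3 ^ᴺ (12 * (9 * (a * a)))
      ≡⟨ cong (3 ^ᴺ_) (exponent″ (a * a)) ⟩
    3 ^ᴺ (108 * (a * a)) ∎
    where
    open ≤-Reasoning
    exponent : ∀ a → suc (a * (12 * a) + a * (12 * a)) + 12 * a * (12 * a) ≡ 1 + 168 * (a * a)
    exponent = solve-∀
    exponent′ : ∀ q → 3 * q + 168 * q ≡ 19 * (9 * q)
    exponent′ = solve-∀
    exponent″ : ∀ q → 12 * (9 * q) ≡ 108 * q
    exponent″ = solve-∀

  many : ∀ (g : Fin (2 ^ᴺ a) → Fin (2 ^ᴺ a) → Bool) c (X Y : Subset (2 ^ᴺ a)) → ∣ X ∣ ≡ 12 * a → ∣ Y ∣ ≡ 12 * a →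
    ∑∑ (λ i j → 𝟙 ((lookup X i ∧ lookup Y j) ∧ not (c xor g i j))) < 108 * (a * a) →
    12 * a * (12 * a) ≤ 4 * ∑∑ (λ i j → 𝟙 (lookup X i) * (𝟙 (lookup Y j) * 𝟙 (c xor g i j)))
  many g c X Y p q few = +-cancelˡ-≤ (4 * (108 * (a * a))) _ _ (begin
    4 * (108 * (a * a)) + 12 * a * (12 * a)   ≡⟨ expand a ⟩
    4 * (12 * a * (12 * a))                   ≡⟨ cong (4 *_) split ⟩
    4 * (agree + differ)                      ≡⟨ *-distribˡ-+ 4 agree differ ⟩
    4 * agree + 4 * differ                    ≤⟨ +-monoˡ-≤ (4 * differ) (*-monoʳ-≤ 4 (<⇒≤ few)) ⟩
    4 * (108 * (a * a)) + 4 * differ          ∎)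
    where
    open ≤-Reasoning
    agree = ∑∑ (λ i j → 𝟙 ((lookup X i ∧ lookup Y j) ∧ not (c xor g i j)))
    differ = ∑∑ (λ i j → 𝟙 (lookup X i) * (𝟙 (lookup Y j) * 𝟙 (c xor g i j)))
    expand : ∀ a → 4 * (108 * (a * a)) + 12 * a * (12 * a) ≡ 4 * (12 * a * (12 * a))
    expand = solve-∀
    cases : ∀ x y h → 𝟙 (x ∧ y) ≡ 𝟙 ((x ∧ y) ∧ not h) + 𝟙 x * (𝟙 y * 𝟙 h)
    cases false y     h     = refl
    cases true  false h     = refl
    cases true  true  false = refl
    cases true  true  true  = refl
    split : 12 * a * (12 * a) ≡ agree + differ
    split = trans (sym (cong₂ _*_ p q)) (trans (sym (∑∑-× X Y))
      (trans (∑∑-cong λ i j → cases (lookup X i) (lookup Y j) (c xor g i j)) (∑∑-+ (λ i j → 𝟙 ((lookup X i ∧ lookup Y j) ∧ not (c xor g i j))) (λ i j → 𝟙 (lookup X i) * (𝟙 (lookup Y j) * 𝟙 (c xor g i j))))))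

-- From submatrices to lists of indices of bounded multiplicity.

subset-of-size : ∀ (S : Subset k) t → t ≤ ∣ S ∣ →
  ∃ λ X → ∣ X ∣ ≡ t × (∀ i → 𝟙 (lookup X i) ≤ 𝟙 (lookup S i))
subset-of-size []          zero    _ = [] , refl , λ ()
subset-of-size (false ∷ S) t       le with X , eq , X⊆S ← subset-of-size S t le
  = false ∷ X , eq , λ { zero → z≤n ; (suc i) → X⊆S i }
subset-of-size (true ∷ S)  zero    _ with X , eq , X⊆S ← subset-of-size S zero z≤n
  = false ∷ X , eq , λ { zero → z≤n ; (suc i) → X⊆S i }
subset-of-size (true ∷ S)  (suc t) (s≤s le) with X , eq , X⊆S ← subset-of-size S t le
  = true ∷ X , cong suc eq , λ { zero → ≤-refl ; (suc i) → X⊆S i }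

multiplicity : List (Fin k) → Fin k → ℕ
multiplicity xs i = ∑ xs λ x → 𝟙 (does (x Fin.≟ i))

∑-δ : ∀ (x : Fin k) (f : Fin k → ℕ) → ∑ (allFin k) (λ i → f i * 𝟙 (does (x Fin.≟ i))) ≡ f x
∑-δ {suc k} zero f = trans (∑-suc (λ i → f i * 𝟙 (does (zero Fin.≟ i)))) (trans (cong₂ _+_ (*-identityʳ (f zero))
  (trans (∑-cong (allFin k) (λ i → *-zeroʳ (f (suc i)))) (trans (∑-allFin-const k 0) (*-zeroʳ k)))) (+-identityʳ (f zero)))
∑-δ {suc k} (suc x) f = trans (∑-suc (λ i → f i * 𝟙 (does (suc x Fin.≟ i)))) (cong₂ _+_ (*-zeroʳ (f zero)) (∑-δ x (f ∘ suc)))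

∑-by-value : ∀ (xs : List (Fin k)) f → ∑ xs f ≡ ∑ (allFin k) (λ i → f i * multiplicity xs i)
∑-by-value {k} xs f = begin
  ∑ xs f                                                                   ≡⟨ ∑-cong xs (λ x → ∑-δ x f) ⟨
  ∑ xs (λ x → ∑ (allFin k) (λ i → f i * 𝟙 (does (x Fin.≟ i))))             ≡⟨ ∑-swap xs (allFin k) ⟩
  ∑ (allFin k) (λ i → ∑ xs (λ x → f i * 𝟙 (does (x Fin.≟ i))))             ≡⟨ ∑-cong (allFin k) (λ i → ∑-*ˡ xs (f i)) ⟩
  ∑ (allFin k) (λ i → f i * multiplicity xs i)                             ∎
  where open ≡-Reasoning

-- Fewer than t values i can have w i < θ, and they account for at most s * t members of xs.
spread-weight : ∀ (w : Fin k → ℕ) θ {t s m} xs → 0 < t →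
  (∀ X → ∣ X ∣ ≡ t → t * θ ≤ ∑ (allFin k) (λ i → 𝟙 (lookup X i) * w i)) →
  (∀ i → multiplicity xs i ≤ s) → m + s * t ≤ length xs → m * θ ≤ ∑ xs w
spread-weight {k} w θ {t} {s} {m} xs 0<t heavy spread long with t ≤? ∣ Vec.tabulate (λ i → w i <ᵇ θ) ∣
-- The t light values would together weigh at most t * θ - t, contradicting `heavy`.
... | yes t≤ with X , ∣X∣≡t , X⊆ ← subset-of-size (Vec.tabulate (λ i → w i <ᵇ θ)) t t≤ = contradiction (heavy X ∣X∣≡t) (<⇒≱ (begin-strict
  ∑ (allFin k) (λ i → 𝟙 (lookup X i) * w i)
    <⟨ m<n+m _ 0<t ⟩
  t + ∑ (allFin k) (λ i → 𝟙 (lookup X i) * w i)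
    ≡⟨ cong (_+ ∑ (allFin k) (λ i → 𝟙 (lookup X i) * w i)) (trans (sym ∣X∣≡t) (∣∣≡∑ X)) ⟩
  ∑ (allFin k) (λ i → 𝟙 (lookup X i)) + ∑ (allFin k) (λ i → 𝟙 (lookup X i) * w i)
    ≡⟨ ∑-+ (allFin k) ⟨
  ∑ (allFin k) (λ i → 𝟙 (lookup X i) + 𝟙 (lookup X i) * w i)
    ≤⟨ ∑-mono (allFin k) light ⟩
  ∑ (allFin k) (λ i → 𝟙 (lookup X i) * θ)
    ≡⟨ ∑-*ʳ (allFin k) θ ⟩
  ∑ (allFin k) (λ i → 𝟙 (lookup X i)) * θ
    ≡⟨ cong (_* θ) (trans (sym (∣∣≡∑ X)) ∣X∣≡t) ⟩
  t * θ ∎))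
  where
  open ≤-Reasoning
  below : ∀ x θ b → 𝟙 b ≤ 𝟙 (x <ᵇ θ) → 𝟙 b + 𝟙 b * x ≤ 𝟙 b * θ
  below x θ false _ = z≤n
  below x θ true  h with x <ᵇ θ in eq
  ... | true = begin
    suc (x + 0) ≡⟨ cong suc (+-identityʳ x) ⟩
    suc x       ≤⟨ <ᵇ⇒< x θ (subst T (sym eq) _) ⟩
    θ           ≡⟨ +-identityʳ θ ⟨
    θ + 0       ∎
  below x θ true () | false
  light : ∀ i → 𝟙 (lookup X i) + 𝟙 (lookup X i) * w i ≤ 𝟙 (lookup X i) * θ
  light i = below (w i) θ (lookup X i) (subst (λ b → 𝟙 (lookup X i) ≤ 𝟙 b) (lookup∘tabulate (λ i → w i <ᵇ θ) i) (X⊆ i))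
... | no t≰ = +-cancelʳ-≤ (s * t * θ) _ _ (begin
  m * θ + s * t * θ
    ≡⟨ *-distribʳ-+ θ m (s * t) ⟨
  (m + s * t) * θ
    ≤⟨ *-monoˡ-≤ θ long ⟩
  length xs * θ
    ≡⟨ ∑-const xs θ ⟨
  ∑ xs (λ _ → θ)
    ≤⟨ ∑-mono xs above ⟩
  ∑ xs (λ x → w x + low x * θ)
    ≡⟨ ∑-+ xs ⟩
  ∑ xs w + ∑ xs (λ x → low x * θ)
    ≡⟨ cong (∑ xs w +_) (∑-*ʳ xs θ) ⟩
  ∑ xs w + ∑ xs low * θ
    ≡⟨ cong (λ z → ∑ xs w + z * θ) (∑-by-value xs low) ⟩
  ∑ xs w + ∑ (allFin k) (λ i → low i * multiplicity xs i) * θ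
    ≤⟨ +-monoʳ-≤ (∑ xs w) (*-monoˡ-≤ θ (∑-mono (allFin k) λ i → *-monoʳ-≤ (low i) (spread i))) ⟩
  ∑ xs w + ∑ (allFin k) (λ i → low i * s) * θ
    ≡⟨ cong (λ z → ∑ xs w + z * θ) (trans (∑-*ʳ (allFin k) s) (*-comm _ s)) ⟩
  ∑ xs w + s * ∑ (allFin k) low * θ
    ≤⟨ +-monoʳ-≤ (∑ xs w) (*-monoˡ-≤ θ (*-monoʳ-≤ s low≤t)) ⟩
  ∑ xs w + s * t * θ ∎)
  where
  open ≤-Reasoning
  low : Fin k → ℕ
  low i = 𝟙 (w i <ᵇ θ)
  low≤t : ∑ (allFin k) low ≤ t
  low≤t = begin
    ∑ (allFin k) low ≡⟨ ∑-cong (allFin k) (λ i → cong 𝟙 (lookup∘tabulate (λ i → w i <ᵇ θ) i)) ⟨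
    ∑ (allFin k) (λ i → 𝟙 (lookup (Vec.tabulate (λ i → w i <ᵇ θ)) i)) ≡⟨ ∣∣≡∑ (Vec.tabulate (λ i → w i <ᵇ θ)) ⟨
    ∣ Vec.tabulate (λ i → w i <ᵇ θ) ∣ ≤⟨ ≰⇒≥ t≰ ⟩
    t ∎
  above : ∀ i → θ ≤ w i + low i * θ
  above i with w i <ᵇ θ in eq
  ... | true  = ≤-trans (≤-reflexive (sym (+-identityʳ θ))) (m≤n+m (θ + 0) (w i))
  ... | false = ≤-trans (≮⇒≥ λ lt → subst T eq (<⇒<ᵇ lt)) (m≤m+n (w i) 0)

-- `spread-weight` is applied twice. For a fixed t-set X of rows, `Dense` gives every t-set of
-- columns weight at least t * t, so `ys` has column weight at least m * t. Read as a statement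
-- about rows, every t-set X has weight at least t * m, so `xs` has weight at least m * m.
dense-on-lists : ∀ (H : Fin k → Fin k → Bool) {t s m} xs ys → 0 < t → Dense t H →
  (∀ i → multiplicity xs i ≤ s) → (∀ j → multiplicity ys j ≤ s) →
  m + s * t ≤ length xs → m + s * t ≤ length ys →
  m * m ≤ 4 * ∑ xs (λ i → ∑ ys (λ j → 𝟙 (H i j)))
dense-on-lists {k} H {t} {s} {m} xs ys 0<t dense spread-xs spread-ys long-xs long-ys = begin
  m * m                                            ≤⟨ spread-weight (λ i → 4 * ∑ ys (λ j → 𝟙 (H i j))) m xs 0<t outer spread-xs long-xs ⟩
  ∑ xs (λ i → 4 * ∑ ys (λ j → 𝟙 (H i j)))          ≡⟨ ∑-*ˡ xs 4 ⟩
  4 * ∑ xs (λ i → ∑ ys (λ j → 𝟙 (H i j)))          ∎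
  where
  open ≤-Reasoning
  swap₃ : ∀ x y z → x * (y * z) ≡ y * (x * z)
  swap₃ = solve-∀
  column : Subset k → Fin k → ℕ
  column X j = 4 * ∑ (allFin k) (λ i → 𝟙 (lookup X i) * 𝟙 (H i j))
  inner : ∀ X → ∣ X ∣ ≡ t → ∀ Y → ∣ Y ∣ ≡ t → t * t ≤ ∑ (allFin k) (λ j → 𝟙 (lookup Y j) * column X j)
  inner X p Y q = begin
    t * t
      ≤⟨ dense X Y p q ⟩
    4 * ∑∑ (λ i j → 𝟙 (lookup X i) * (𝟙 (lookup Y j) * 𝟙 (H i j)))
      ≡⟨ cong (4 *_) (∑-swap (allFin k) (allFin k)) ⟩
    4 * ∑ (allFin k) (λ j → ∑ (allFin k) (λ i → 𝟙 (lookup X i) * (𝟙 (lookup Y j) * 𝟙 (H i j))))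
      ≡⟨ cong (4 *_) (∑-cong (allFin k) λ j → trans (∑-cong (allFin k) λ i → swap₃ (𝟙 (lookup X i)) (𝟙 (lookup Y j)) (𝟙 (H i j))) (∑-*ˡ (allFin k) (𝟙 (lookup Y j)))) ⟩
    4 * ∑ (allFin k) (λ j → 𝟙 (lookup Y j) * ∑ (allFin k) (λ i → 𝟙 (lookup X i) * 𝟙 (H i j)))
      ≡⟨ ∑-*ˡ (allFin k) 4 ⟨
    ∑ (allFin k) (λ j → 4 * (𝟙 (lookup Y j) * ∑ (allFin k) (λ i → 𝟙 (lookup X i) * 𝟙 (H i j))))
      ≡⟨ ∑-cong (allFin k) (λ j → swap₃ 4 (𝟙 (lookup Y j)) _) ⟩
    ∑ (allFin k) (λ j → 𝟙 (lookup Y j) * column X j) ∎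
  outer : ∀ X → ∣ X ∣ ≡ t → t * m ≤ ∑ (allFin k) (λ i → 𝟙 (lookup X i) * (4 * ∑ ys (λ j → 𝟙 (H i j))))
  outer X p = begin
    t * m
      ≡⟨ *-comm t m ⟩
    m * t
      ≤⟨ spread-weight (column X) t ys 0<t (inner X p) spread-ys long-ys ⟩
    ∑ ys (column X)
      ≡⟨ ∑-*ˡ ys 4 ⟩
    4 * ∑ ys (λ j → ∑ (allFin k) (λ i → 𝟙 (lookup X i) * 𝟙 (H i j)))
      ≡⟨ cong (4 *_) (∑-swap ys (allFin k)) ⟩
    4 * ∑ (allFin k) (λ i → ∑ ys (λ j → 𝟙 (lookup X i) * 𝟙 (H i j)))
      ≡⟨ cong (4 *_) (∑-cong (allFin k) λ i → ∑-*ˡ ys (𝟙 (lookup X i))) ⟩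
    4 * ∑ (allFin k) (λ i → 𝟙 (lookup X i) * ∑ ys (λ j → 𝟙 (H i j)))
      ≡⟨ ∑-*ˡ (allFin k) 4 ⟨
    ∑ (allFin k) (λ i → 4 * (𝟙 (lookup X i) * ∑ ys (λ j → 𝟙 (H i j))))
      ≡⟨ ∑-cong (allFin k) (λ i → swap₃ 4 (𝟙 (lookup X i)) _) ⟩
    ∑ (allFin k) (λ i → 𝟙 (lookup X i) * (4 * ∑ ys (λ j → 𝟙 (H i j)))) ∎

-- Pairs of blocks joined against the required direction.

T⇒≡true : ∀ {b} → T b → b ≡ true
T⇒≡true {true} _ = refl

≡true⇒T : ∀ {b} → b ≡ true → T b
≡true⇒T refl = _

≡true⇒< : ∀ {m n} → (m <ᵇ n) ≡ true → m < n
≡true⇒< {m} {n} eq = <ᵇ⇒< m n (≡true⇒T eq)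

<⇒≡true : ∀ {m n} → m < n → (m <ᵇ n) ≡ true
<⇒≡true lt = T⇒≡true (<⇒<ᵇ lt)

length-filterᵇ : ∀ (P : A → Bool) xs → length (filterᵇ P xs) ≡ ∑ xs (𝟙 ∘ P)
length-filterᵇ P xs = trans (length-∑ (filterᵇ P xs))
  (trans (∑-filter (T? ∘ P) xs) (∑-cong xs λ x → *-identityʳ (𝟙 (P x))))

∑-filterᵇ-≤ : ∀ (P : A → Bool) xs {f g} → (∀ x → P x ≡ true → f x ≤ g x) → ∑ (filterᵇ P xs) f ≤ ∑ xs g
∑-filterᵇ-≤ P xs {f} {g} h = ≤-trans (≤-reflexive (∑-filter (T? ∘ P) xs)) (∑-mono xs pointwise)
  where
  pointwise : ∀ x → 𝟙 (P x) * f x ≤ g x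
  pointwise x with P x in eq
  ... | true  = ≤-trans (≤-reflexive (+-identityʳ (f x))) (h x eq)
  ... | false = z≤n

crossing : ∀ (F : ℕ → ℕ) {ℓ} k → F 0 < ℓ → ℓ ≤ F k → ∃ λ q → q < k × F q < ℓ × ℓ ≤ F (suc q)
crossing F zero    below above = contradiction above (<⇒≱ below)
crossing F {ℓ} (suc k) below above with ℓ ≤? F k
... | yes p with q , q<k , r ← crossing F k below p = q , m≤n⇒m≤1+n q<k , r
... | no ¬p = k , ≤-refl , ≰⇒> ¬p , above

-- No vertex of block i has an edge to a vertex of block j, when g orients the blocks.
against : (Fin k → Fin k → Bool) → Fin k → Fin k → Bool
against g i j = ((toℕ i <ᵇ toℕ j) ∧ not (g i j)) ∨ ((toℕ j <ᵇ toℕ i) ∧ g j i)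

Dense-transpose : ∀ {t} {H : Fin k → Fin k → Bool} → Dense t H → Dense t (λ i j → H j i)
Dense-transpose {k} {t} {H} dense X Y p q = ≤-trans (dense Y X q p) (≤-reflexive (cong (4 *_)
  (trans (∑-swap (allFin k) (allFin k))
    (∑∑-cong λ i j → swap₃ (𝟙 (lookup Y j)) (𝟙 (lookup X i)) (𝟙 (H j i))))))
  where
  swap₃ : ∀ x y z → x * (y * z) ≡ y * (x * z)
  swap₃ = solve-∀

-- Cutting at a median of xs puts a constant proportion of xs on one side of the cut and of ys on the
-- other, so that against g reads only one side of the diagonal and looks for one fixed bit.
against-dense : ∀ (g : Fin k → Fin k → Bool) {t s m} xs ys → 0 < s → 0 < t → (∀ c → Dense t (λ i j → c xor g i j)) →
  (∀ i → multiplicity xs i ≤ s) → (∀ j → multiplicity ys j ≤ s) →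
  (m + s * t) + (m + s * t) ≤ length xs → (m + s * t) + (m + s * t) + s ≤ length ys →
  m * m ≤ 4 * ∑ xs (λ i → ∑ ys (λ j → 𝟙 (against g i j)))
against-dense {k} g {t} {s} {m} xs ys 0<s 0<t dense spread-xs spread-ys long-xs long-ys =
  let q , q<k , below , above = crossing (λ q → ∑ xs (λ x → 𝟙 (toℕ x <ᵇ q))) {m + s * t} k at-0 at-k
  in cases q q<k below above
  where
  open ≤-Reasoning
  ℓ = m + s * t

  at-0 : ∑ xs (λ x → 𝟙 (toℕ x <ᵇ 0)) < m + s * t
  at-0 = begin-strict
    ∑ xs (λ x → 𝟙 (toℕ x <ᵇ 0))  ≡⟨ trans (∑-const xs 0) (*-zeroʳ (length xs)) ⟩
    0                            <⟨ *-mono-≤ 0<s 0<t ⟩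
    s * t                        ≤⟨ m≤n+m (s * t) m ⟩
    m + s * t                    ∎

  at-k : m + s * t ≤ ∑ xs (λ x → 𝟙 (toℕ x <ᵇ k))
  at-k = begin
    m + s * t                    ≤⟨ m≤m+n _ _ ⟩
    (m + s * t) + (m + s * t)    ≤⟨ long-xs ⟩
    length xs                    ≡⟨ length-∑ xs ⟩
    ∑ xs (λ _ → 1)               ≡⟨ ∑-cong xs (λ x → cong 𝟙 (<⇒≡true (Fin.toℕ<n x))) ⟨
    ∑ xs (λ x → 𝟙 (toℕ x <ᵇ k))  ∎

  cases : ∀ q → q < k → ∑ xs (λ x → 𝟙 (toℕ x <ᵇ q)) < ℓ → ℓ ≤ ∑ xs (λ x → 𝟙 (toℕ x <ᵇ suc q)) →
    m * m ≤ 4 * ∑ xs (λ i → ∑ ys (λ j → 𝟙 (against g i j)))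
  -- If ℓ elements of `ys` lie strictly above `q`, they are paired with the ℓ elements of `xs` at or
  -- below `q`: there i < j, and `against` reads `not (g i j)`.
  cases q q<k below above with ℓ ≤? ∑ ys (λ y → 𝟙 (q <ᵇ toℕ y))
  ... | yes many = begin
    m * m
      ≤⟨ dense-on-lists (λ i j → true xor g i j) (filterᵇ P xs) (filterᵇ Q ys) 0<t (dense true)
          (λ i → ≤-trans (∑-filterᵇ-≤ P xs (λ _ _ → ≤-refl)) (spread-xs i))
          (λ i → ≤-trans (∑-filterᵇ-≤ Q ys (λ _ _ → ≤-refl)) (spread-ys i))
          (≤-trans above (≤-reflexive (sym (length-filterᵇ P xs))))
          (≤-trans many (≤-reflexive (sym (length-filterᵇ Q ys)))) ⟩
    4 * ∑ (filterᵇ P xs) (λ i → ∑ (filterᵇ Q ys) (λ j → 𝟙 (not (g i j))))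
      ≤⟨ *-monoʳ-≤ 4 (∑-filterᵇ-≤ P xs λ i Pi → ∑-filterᵇ-≤ Q ys λ j Qj → pointwise i j Pi Qj) ⟩
    4 * ∑ xs (λ i → ∑ ys (λ j → 𝟙 (against g i j))) ∎
    where
    P Q : Fin k → Bool
    P x = toℕ x <ᵇ suc q
    Q y = q <ᵇ toℕ y
    pointwise : ∀ i j → P i ≡ true → Q j ≡ true → 𝟙 (not (g i j)) ≤ 𝟙 (against g i j)
    pointwise i j Pi Qj rewrite <⇒≡true {toℕ i} {toℕ j} (≤-<-trans (≤-pred (≡true⇒< Pi)) (≡true⇒< Qj)) with not (g i j)
    ... | true  = ≤-refl
    ... | false = z≤n
  -- At least ℓ of `xs` are not below `q`, as fewer than ℓ are below. Of `ys`, fewer than ℓ lie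
  -- above `q` and at most s equal it, which is why `long-ys` has an extra s; the other ℓ lie
  -- strictly below. There j < i, and `against` reads `g j i`, hence the transpose.
  ... | no few = begin
    m * m
      ≤⟨ dense-on-lists (λ i j → false xor g j i) (filterᵇ P xs) (filterᵇ Q ys) 0<t (Dense-transpose {H = λ i j → false xor g i j} (dense false))
          (λ i → ≤-trans (∑-filterᵇ-≤ P xs (λ _ _ → ≤-refl)) (spread-xs i))
          (λ i → ≤-trans (∑-filterᵇ-≤ Q ys (λ _ _ → ≤-refl)) (spread-ys i))
          (≤-trans above′ (≤-reflexive (sym (length-filterᵇ P xs))))
          (≤-trans many (≤-reflexive (sym (length-filterᵇ Q ys)))) ⟩
    4 * ∑ (filterᵇ P xs) (λ i → ∑ (filterᵇ Q ys) (λ j → 𝟙 (g j i)))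
      ≤⟨ *-monoʳ-≤ 4 (∑-filterᵇ-≤ P xs λ i Pi → ∑-filterᵇ-≤ Q ys λ j Qj → pointwise i j Pi Qj) ⟩
    4 * ∑ xs (λ i → ∑ ys (λ j → 𝟙 (against g i j))) ∎
    where
    P Q : Fin k → Bool
    P x = not (toℕ x <ᵇ q)
    Q y = toℕ y <ᵇ q
    p = fromℕ< q<k

    pointwise : ∀ i j → P i ≡ true → Q j ≡ true → 𝟙 (g j i) ≤ 𝟙 (against g i j)
    pointwise i j Pi Qj with toℕ i <? q
    ... | yes i<q with () ← trans (sym Pi) (cong not (<⇒≡true i<q))
    ... | no  i≮q rewrite <⇒≡true {toℕ j} {toℕ i} (<-≤-trans (≡true⇒< Qj) (≮⇒≥ i≮q))
      with g j i
    ... | true  rewrite ∨-zeroʳ ((toℕ i <ᵇ toℕ j) ∧ not (g i j)) = ≤-refl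
    ... | false = z≤n

    complement : ∀ b → 1 ≡ 𝟙 b + 𝟙 (not b)
    complement true  = refl
    complement false = refl

    above′ : ℓ ≤ ∑ xs (𝟙 ∘ P)
    above′ = +-cancelˡ-≤ ℓ _ _ (begin
      ℓ + ℓ                                              ≤⟨ long-xs ⟩
      length xs                                          ≡⟨ length-∑ xs ⟩
      ∑ xs (λ _ → 1)                                     ≡⟨ ∑-cong xs (λ x → complement (toℕ x <ᵇ q)) ⟩
      ∑ xs (λ x → 𝟙 (toℕ x <ᵇ q) + 𝟙 (P x))              ≡⟨ ∑-+ xs ⟩
      ∑ xs (λ x → 𝟙 (toℕ x <ᵇ q)) + ∑ xs (𝟙 ∘ P)         ≤⟨ +-monoˡ-≤ _ (<⇒≤ below) ⟩
      ℓ + ∑ xs (𝟙 ∘ P)                                   ∎)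

    trichotomy : ∀ y → 1 ≤ 𝟙 (Q y) + (𝟙 (q <ᵇ toℕ y) + 𝟙 (does (y Fin.≟ p)))
    trichotomy y with <-cmp (toℕ y) q
    ... | tri< lt _ _ rewrite <⇒≡true lt = s≤s z≤n
    ... | tri> _ _ gt rewrite <⇒≡true gt = m≤n⇒m≤o+n (𝟙 (Q y)) (s≤s z≤n)
    ... | tri≈ _ eq _ rewrite dec-true (y Fin.≟ p) (Fin.toℕ-injective (trans eq (sym (Fin.toℕ-fromℕ< q<k)))) =
      m≤n⇒m≤o+n (𝟙 (Q y)) (m≤n+m 1 (𝟙 (q <ᵇ toℕ y)))

    many : ℓ ≤ ∑ ys (𝟙 ∘ Q)
    many = +-cancelʳ-≤ (ℓ + s) _ _ (begin
      ℓ + (ℓ + s)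
        ≡⟨ +-assoc ℓ ℓ s ⟨
      ℓ + ℓ + s
        ≤⟨ long-ys ⟩
      length ys
        ≡⟨ length-∑ ys ⟩
      ∑ ys (λ _ → 1)
        ≤⟨ ∑-mono ys trichotomy ⟩
      ∑ ys (λ y → 𝟙 (Q y) + (𝟙 (q <ᵇ toℕ y) + 𝟙 (does (y Fin.≟ p))))
        ≡⟨ trans (∑-+ ys) (cong (∑ ys (𝟙 ∘ Q) +_) (∑-+ ys)) ⟩
      ∑ ys (𝟙 ∘ Q) + (∑ ys (λ y → 𝟙 (q <ᵇ toℕ y)) + multiplicity ys p)
        ≤⟨ +-monoʳ-≤ (∑ ys (𝟙 ∘ Q)) (+-mono-≤ (≰⇒≥ few) (spread-ys p)) ⟩
      ∑ ys (𝟙 ∘ Q) + (ℓ + s) ∎)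

-- The bipartite digraph of an adjacency matrix.

∑-↑ : ∀ m n (f : Fin (m + n) → ℕ) →
  ∑ (allFin (m + n)) f ≡ ∑ (allFin m) (λ a → f (a ↑ˡ n)) + ∑ (allFin n) (λ b → f (m ↑ʳ b))
∑-↑ zero    n f = refl
∑-↑ (suc m) n f = begin
  ∑ (allFin (suc (m + n))) f
    ≡⟨ ∑-suc f ⟩
  f zero + ∑ (allFin (m + n)) (f ∘ suc)
    ≡⟨ cong (f zero +_) (∑-↑ m n (f ∘ suc)) ⟩
  f zero + (∑ (allFin m) (λ a → f (suc a ↑ˡ n)) + ∑ (allFin n) (λ b → f (suc m ↑ʳ b)))
    ≡⟨ +-assoc (f zero) _ _ ⟨
  f zero + ∑ (allFin m) (λ a → f (suc a ↑ˡ n)) + ∑ (allFin n) (λ b → f (suc m ↑ʳ b))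
    ≡⟨ cong (_+ ∑ (allFin n) (λ b → f (suc m ↑ʳ b))) (∑-suc (λ a → f (a ↑ˡ n))) ⟨
  ∑ (allFin (suc m)) (λ a → f (a ↑ˡ n)) + ∑ (allFin n) (λ b → f (suc m ↑ʳ b)) ∎
  where open ≡-Reasoning

∑-zero : ∀ n → ∑ (allFin n) (λ _ → 0) ≡ 0
∑-zero n = trans (∑-allFin-const n 0) (*-zeroʳ n)

∑-one : ∀ n → ∑ (allFin n) (λ _ → 1) ≡ n
∑-one n = trans (∑-allFin-const n 1) (*-identityʳ n)

∣tabulate∣ : (P : Fin n → Bool) → ∣ tabulate P ∣ ≡ ∑ (allFin n) (𝟙 ∘ P)
∣tabulate∣ {n} P = trans (∣∣≡∑ (tabulate P)) (∑-cong (allFin n) λ i → cong 𝟙 (lookup∘tabulate P i))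

∈-tabulate : (P : Fin n → Bool) {i : Fin n} → P i ≡ true → i Subset.∈ tabulate P
∈-tabulate P {i} eq = lookup⇒[]= i _ (trans (lookup∘tabulate P i) eq)

tabulate-∈ : (P : Fin n → Bool) {i : Fin n} → i Subset.∈ tabulate P → P i ≡ true
tabulate-∈ P {i} i∈ = trans (sym (lookup∘tabulate P i)) ([]=⇒lookup i∈)

module Bipartite (n : ℕ) (adj : Fin n → Fin n → Bool) where

  isLeft : Fin n ⊎ Fin n → Bool
  isLeft (inj₁ _) = true
  isLeft (inj₂ _) = false

  arc : Fin n ⊎ Fin n → Fin n ⊎ Fin n → Bool
  arc (inj₁ a) (inj₂ b) = adj a b
  arc (inj₁ _) (inj₁ _) = false
  arc (inj₂ _) _        = false

  arc-loopless : ∀ x → ¬ T (arc x x)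
  arc-loopless (inj₁ _) ()
  arc-loopless (inj₂ _) ()

  arc-directed : ∀ x y → T (arc x y) → isLeft x ≡ true × not (isLeft y) ≡ true
  arc-directed (inj₁ _) (inj₂ _) _ = refl , refl

  graph : Digraph (Fin (n + n))
  graph = record
    { edge     = λ u v → arc (splitAt n u) (splitAt n v)
    ; loopless = λ v → arc-loopless (splitAt n v)
    }

  left right : Subset (n + n)
  left  = tabulate (λ u → isLeft (splitAt n u))
  right = tabulate (λ u → not (isLeft (splitAt n u)))

  graph-bipartite : IsBipartiteFromTo graph left right
  graph-bipartite = record
    { cover    = ⊆-antisym ⊆⊤ (λ {u} _ → x∈p∪q⁺ (side u))
    ; disjoint = ⊆-antisym (λ {u} u∈ → contradiction (x∈p∩q⁻ left right u∈) (not-both u)) ⊥⊆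
    ; directed = λ u v e → let p , q = arc-directed (splitAt n u) (splitAt n v) e in
                           ∈-tabulate _ p , ∈-tabulate _ q
    }
    where
    side : ∀ u → u Subset.∈ left ⊎ u Subset.∈ right
    side u with isLeft (splitAt n u) in eq
    ... | true  = inj₁ (∈-tabulate _ eq)
    ... | false = inj₂ (∈-tabulate _ (cong not eq))
    not-both : ∀ u → ¬ (u Subset.∈ left × u Subset.∈ right)
    not-both u (p , q) with () ← trans (sym (cong not (tabulate-∈ (λ u → isLeft (splitAt n u)) p))) (tabulate-∈ (λ u → not (isLeft (splitAt n u))) q)

  ∣∣-split : (S : Subset (n + n)) →
    ∣ S ∣ ≡ ∑ (allFin n) (λ a → 𝟙 (lookup S (a ↑ˡ n))) + ∑ (allFin n) (λ b → 𝟙 (lookup S (n ↑ʳ b)))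
  ∣∣-split S = trans (∣∣≡∑ S) (∑-↑ n n _)

  right⇒¬left : ∀ {S} → S Subset.⊆ left → ∀ b → lookup S (n ↑ʳ b) ≡ false
  right⇒¬left {S} S⊆ b with lookup S (n ↑ʳ b) in eq
  ... | false = refl
  ... | true with () ← trans (sym (tabulate-∈ (λ u → isLeft (splitAt n u)) (S⊆ (lookup⇒[]= _ S eq)))) (cong isLeft (Fin.splitAt-↑ʳ n n b))

  left⇒¬right : ∀ {S} → S Subset.⊆ right → ∀ a → lookup S (a ↑ˡ n) ≡ false
  left⇒¬right {S} S⊆ a with lookup S (a ↑ˡ n) in eq
  ... | false = refl
  ... | true with () ← trans (sym (tabulate-∈ (λ u → not (isLeft (splitAt n u))) (S⊆ (lookup⇒[]= _ S eq)))) (cong (not ∘ isLeft) (Fin.splitAt-↑ˡ n a n))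

  ∣∣-left : ∀ {S} → S Subset.⊆ left → ∣ S ∣ ≡ ∑ (allFin n) (λ a → 𝟙 (lookup S (a ↑ˡ n)))
  ∣∣-left {S} S⊆ = trans (∣∣-split S) (trans (cong (∑ (allFin n) (λ a → 𝟙 (lookup S (a ↑ˡ n))) +_)
    (trans (∑-cong (allFin n) λ b → cong 𝟙 (right⇒¬left S⊆ b)) (∑-zero n))) (+-identityʳ _))

  ∣∣-right : ∀ {S} → S Subset.⊆ right → ∣ S ∣ ≡ ∑ (allFin n) (λ b → 𝟙 (lookup S (n ↑ʳ b)))
  ∣∣-right {S} S⊆ = trans (∣∣-split S) (cong (_+ ∑ (allFin n) (λ b → 𝟙 (lookup S (n ↑ʳ b))))
    (trans (∑-cong (allFin n) λ a → cong 𝟙 (left⇒¬right S⊆ a)) (∑-zero n)))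

  ∣left∣ : ∣ left ∣ ≡ n
  ∣left∣ = trans (∣∣-left id) (trans (∑-cong (allFin n) λ a → cong 𝟙
    (trans (lookup∘tabulate _ (a ↑ˡ n)) (cong isLeft (Fin.splitAt-↑ˡ n a n)))) (∑-one n))

  ∣right∣ : ∣ right ∣ ≡ n
  ∣right∣ = trans (∣∣-right id) (trans (∑-cong (allFin n) λ b → cong 𝟙
    (trans (lookup∘tabulate _ (n ↑ʳ b)) (cong (not ∘ isLeft) (Fin.splitAt-↑ʳ n n b)))) (∑-one n))

  edge-↑ : ∀ a b → edge graph (a ↑ˡ n) (n ↑ʳ b) ≡ adj a b
  edge-↑ a b = cong₂ arc (Fin.splitAt-↑ˡ n a n) (Fin.splitAt-↑ʳ n n b)

  degree-left : ∀ a → degree graph (a ↑ˡ n) ≡ ∑ (allFin n) (λ b → 𝟙 (adj a b))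
  degree-left a = begin
    degree graph (a ↑ˡ n)
      ≡⟨ ∣tabulate∣ (λ u → edge graph (a ↑ˡ n) u ∨ edge graph u (a ↑ˡ n)) ⟩
    ∑ (allFin (n + n)) (λ u → 𝟙 (edge graph (a ↑ˡ n) u ∨ edge graph u (a ↑ˡ n)))
      ≡⟨ ∑-↑ n n (λ u → 𝟙 (edge graph (a ↑ˡ n) u ∨ edge graph u (a ↑ˡ n))) ⟩
    ∑ (allFin n) (λ a′ → 𝟙 (edge graph (a ↑ˡ n) (a′ ↑ˡ n) ∨ edge graph (a′ ↑ˡ n) (a ↑ˡ n))) +
    ∑ (allFin n) (λ b → 𝟙 (edge graph (a ↑ˡ n) (n ↑ʳ b) ∨ edge graph (n ↑ʳ b) (a ↑ˡ n)))
      ≡⟨ cong₂ _+_ (trans (∑-cong (allFin n) inner) (∑-zero n)) (∑-cong (allFin n) outer) ⟩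
    ∑ (allFin n) (λ b → 𝟙 (adj a b)) ∎
    where
    open ≡-Reasoning
    inner : ∀ a′ → 𝟙 (edge graph (a ↑ˡ n) (a′ ↑ˡ n) ∨ edge graph (a′ ↑ˡ n) (a ↑ˡ n)) ≡ 0
    inner a′ rewrite Fin.splitAt-↑ˡ n a n | Fin.splitAt-↑ˡ n a′ n = refl
    outer : ∀ b → 𝟙 (edge graph (a ↑ˡ n) (n ↑ʳ b) ∨ edge graph (n ↑ʳ b) (a ↑ˡ n)) ≡ 𝟙 (adj a b)
    outer b rewrite Fin.splitAt-↑ˡ n a n | Fin.splitAt-↑ʳ n n b = cong 𝟙 (∨-identityʳ (adj a b))

  degree-right : ∀ b → degree graph (n ↑ʳ b) ≡ ∑ (allFin n) (λ a → 𝟙 (adj a b))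
  degree-right b = begin
    degree graph (n ↑ʳ b)
      ≡⟨ ∣tabulate∣ (λ u → edge graph (n ↑ʳ b) u ∨ edge graph u (n ↑ʳ b)) ⟩
    ∑ (allFin (n + n)) (λ u → 𝟙 (edge graph (n ↑ʳ b) u ∨ edge graph u (n ↑ʳ b)))
      ≡⟨ ∑-↑ n n (λ u → 𝟙 (edge graph (n ↑ʳ b) u ∨ edge graph u (n ↑ʳ b))) ⟩
    ∑ (allFin n) (λ a → 𝟙 (edge graph (n ↑ʳ b) (a ↑ˡ n) ∨ edge graph (a ↑ˡ n) (n ↑ʳ b))) +
    ∑ (allFin n) (λ b′ → 𝟙 (edge graph (n ↑ʳ b) (n ↑ʳ b′) ∨ edge graph (n ↑ʳ b′) (n ↑ʳ b)))
      ≡⟨ cong₂ _+_ (∑-cong (allFin n) outer) (trans (∑-cong (allFin n) inner) (∑-zero n)) ⟩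
    ∑ (allFin n) (λ a → 𝟙 (adj a b)) + 0
      ≡⟨ +-identityʳ _ ⟩
    ∑ (allFin n) (λ a → 𝟙 (adj a b)) ∎
    where
    open ≡-Reasoning
    inner : ∀ b′ → 𝟙 (edge graph (n ↑ʳ b) (n ↑ʳ b′) ∨ edge graph (n ↑ʳ b′) (n ↑ʳ b)) ≡ 0
    inner b′ rewrite Fin.splitAt-↑ʳ n n b | Fin.splitAt-↑ʳ n n b′ = refl
    outer : ∀ a → 𝟙 (edge graph (n ↑ʳ b) (a ↑ˡ n) ∨ edge graph (a ↑ˡ n) (n ↑ʳ b)) ≡ 𝟙 (adj a b)
    outer a rewrite Fin.splitAt-↑ˡ n a n | Fin.splitAt-↑ʳ n n b = refl

  maxDegree-graph : ∀ {Δ} →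
    (∀ a → ∑ (allFin n) (λ b → 𝟙 (adj a b)) ≤ Δ) → (∀ b → ∑ (allFin n) (λ a → 𝟙 (adj a b)) ≤ Δ) →
    (∃ λ a → ∑ (allFin n) (λ b → 𝟙 (adj a b)) ≡ Δ) → maxDegree graph ≡ Δ
  maxDegree-graph {Δ} rows columns (a , full) = max≈v⁺
    (subst (_∈ map (degree graph) (allFin (n + n))) (trans (degree-left a) full) (∈-map⁺ (degree graph) (∈-allFin (a ↑ˡ n))))
    (All.map⁺ (All.universal bounded (allFin (n + n)))) z≤n
    where
    bounded-side : ∀ u x → splitAt n u ≡ x → degree graph u ≤ Δ
    bounded-side u (inj₁ a) eq = subst (λ v → degree graph v ≤ Δ) (Fin.splitAt⁻¹-↑ˡ eq)
      (≤-trans (≤-reflexive (degree-left a)) (rows a))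
    bounded-side u (inj₂ b) eq = subst (λ v → degree graph v ≤ Δ) (Fin.splitAt⁻¹-↑ʳ eq)
      (≤-trans (≤-reflexive (degree-right b)) (columns b))
    bounded : ∀ u → degree graph u ≤ Δ
    bounded u = bounded-side u (splitAt n u) refl

edgeCount-positive : ∀ {N} (D : Digraph (Fin N)) {X Y u v} →
  u Subset.∈ X → v Subset.∈ Y → T (edge D u v) → 0 < edgeCount D X Y
edgeCount-positive D {u = u} {v = v} u∈ v∈ e =
  ∈-length (∈-filter⁺ _ (∈-cartesianProduct⁺ (∈-allFin u) (∈-allFin v)) ((u∈ , v∈) , e))

-- Truncating a list of edges to maximum degree Δ.

∑-initial : ∀ n Δ → Δ ≤ n → ∑ (allFin n) (λ b → 𝟙 (toℕ b <ᵇ Δ)) ≡ Δ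
∑-initial n       zero    _        = ∑-zero n
∑-initial (suc n) (suc Δ) (s≤s le) = trans (∑-suc {n} (λ b → 𝟙 (toℕ b <ᵇ suc Δ))) (cong suc (∑-initial n Δ le))

module Truncation (n Δ : ℕ) (es : List (Fin n × Fin n)) where

  outdegree indegree : Fin n → ℕ
  outdegree a = ∑ es λ e → 𝟙 (does (proj₁ e Fin.≟ a))
  indegree  b = ∑ es λ e → 𝟙 (does (proj₂ e Fin.≟ b))

  -- Vertex 0 is excluded on the left because its row is taken by the star. On the right the strict
  -- bound leaves room for the one edge that the star adds. The list `es` may repeat an edge; the
  -- degrees count repetitions and so can only overestimate.
  keepˡ keepʳ : Fin n → Bool
  keepˡ a = (0 <ᵇ toℕ a) ∧ (outdegree a <ᵇ Δ)
  keepʳ b = indegree b <ᵇ Δ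

  occurrences : Fin n → Fin n → ℕ
  occurrences a b = ∑ es λ e → 𝟙 (does (proj₁ e Fin.≟ a)) * 𝟙 (does (proj₂ e Fin.≟ b))

  -- The star at vertex 0 makes the maximum degree exactly Δ.
  adj : Fin n → Fin n → Bool
  adj a b = (not (0 <ᵇ toℕ a) ∧ (toℕ b <ᵇ Δ)) ∨ ((keepˡ a ∧ keepʳ b) ∧ (0 <ᵇ occurrences a b))

  𝟙-positive-≤ : ∀ m → 𝟙 (0 <ᵇ m) ≤ m
  𝟙-positive-≤ zero    = z≤n
  𝟙-positive-≤ (suc m) = s≤s z≤n

  ∈⇒occurs : ∀ {a b} → (a , b) ∈ es → 0 < occurrences a b
  ∈⇒occurs {a} {b} e∈ = ≤-trans
    (≤-reflexive (sym (cong₂ (λ x y → 𝟙 x * 𝟙 y) (dec-true (a Fin.≟ a) refl) (dec-true (b Fin.≟ b) refl))))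
    (≤-∑ (λ e → 𝟙 (does (proj₁ e Fin.≟ a)) * 𝟙 (does (proj₂ e Fin.≟ b))) e∈)

  adj-∈ : ∀ {a b} → (a , b) ∈ es → keepˡ a ≡ true → keepʳ b ≡ true → adj a b ≡ true
  adj-∈ {a} {b} e∈ p q rewrite p | q | <⇒≡true (∈⇒occurs e∈) = ∨-zeroʳ (not (0 <ᵇ toℕ a) ∧ (toℕ b <ᵇ Δ))

  ∑-occurrences-row : ∀ a → ∑ (allFin n) (occurrences a) ≡ outdegree a
  ∑-occurrences-row a = trans (∑-swap (allFin n) es)
    (∑-cong es λ e → ∑-δ (proj₂ e) (λ _ → 𝟙 (does (proj₁ e Fin.≟ a))))

  ∑-occurrences-column : ∀ b → ∑ (allFin n) (λ a → occurrences a b) ≡ indegree b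
  ∑-occurrences-column b = trans (∑-swap (allFin n) es) (∑-cong es λ e →
    trans (∑-cong (allFin n) λ a → *-comm (𝟙 (does (proj₁ e Fin.≟ a))) _)
          (∑-δ (proj₁ e) (λ _ → 𝟙 (does (proj₂ e Fin.≟ b)))))

  adj-row-≤ : Δ ≤ n → ∀ a → ∑ (allFin n) (λ b → 𝟙 (adj a b)) ≤ Δ
  adj-row-≤ Δ≤n a with 0 <ᵇ toℕ a | outdegree a <ᵇ Δ in eq
  ... | false | _     = ≤-reflexive (trans (∑-cong (allFin n) λ b → cong 𝟙 (∨-identityʳ (toℕ b <ᵇ Δ))) (∑-initial n Δ Δ≤n))
  ... | true  | false = ≤-trans (≤-reflexive (∑-zero n)) z≤n
  ... | true  | true  = begin
    ∑ (allFin n) (λ b → 𝟙 (keepʳ b ∧ (0 <ᵇ occurrences a b)))  ≤⟨ ∑-mono (allFin n) (λ b → 𝟙-∧-≤ (keepʳ b) _) ⟩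
    ∑ (allFin n) (occurrences a)                               ≡⟨ ∑-occurrences-row a ⟩
    outdegree a                                                ≤⟨ <⇒≤ (≡true⇒< eq) ⟩
    Δ                                                          ∎
    where
    open ≤-Reasoning
    𝟙-∧-≤ : ∀ b m → 𝟙 (b ∧ (0 <ᵇ m)) ≤ m
    𝟙-∧-≤ true  m = 𝟙-positive-≤ m
    𝟙-∧-≤ false m = z≤n

  adj-row-0 : Δ ≤ n → ∀ a → toℕ a ≡ 0 → ∑ (allFin n) (λ b → 𝟙 (adj a b)) ≡ Δ
  adj-row-0 Δ≤n a eq rewrite eq = trans (∑-cong (allFin n) λ b → cong 𝟙 (∨-identityʳ (toℕ b <ᵇ Δ))) (∑-initial n Δ Δ≤n)

  ∑-vertex-0 : ∑ (allFin n) (λ a → 𝟙 (not (0 <ᵇ toℕ a))) ≤ 1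
  ∑-vertex-0 = ∑-first n
    where
    ∑-first : ∀ n → ∑ (allFin n) (λ a → 𝟙 (not (0 <ᵇ toℕ a))) ≤ 1
    ∑-first zero    = z≤n
    ∑-first (suc n) = ≤-reflexive (trans (∑-suc {n} (λ a → 𝟙 (not (0 <ᵇ toℕ a)))) (cong suc (∑-zero n)))

  adj-column-≤ : 0 < Δ → ∀ b → ∑ (allFin n) (λ a → 𝟙 (adj a b)) ≤ Δ
  adj-column-≤ 0<Δ b = begin
    ∑ (allFin n) (λ a → 𝟙 (adj a b))
      ≤⟨ ∑-mono (allFin n) (λ a → ≤-trans (𝟙-∨-≤ (not (0 <ᵇ toℕ a) ∧ (toℕ b <ᵇ Δ)) _) (+-mono-≤ (first (not (0 <ᵇ toℕ a)) _) (second (keepˡ a) (keepʳ b) _))) ⟩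
    ∑ (allFin n) (λ a → 𝟙 (not (0 <ᵇ toℕ a)) + 𝟙 (keepʳ b) * occurrences a b)
      ≡⟨ trans (∑-+ (allFin n)) (cong (∑ (allFin n) (λ a → 𝟙 (not (0 <ᵇ toℕ a))) +_) (∑-*ˡ (allFin n) (𝟙 (keepʳ b)))) ⟩
    ∑ (allFin n) (λ a → 𝟙 (not (0 <ᵇ toℕ a))) + 𝟙 (keepʳ b) * ∑ (allFin n) (λ a → occurrences a b)
      ≤⟨ +-mono-≤ ∑-vertex-0 (≤-reflexive (cong (𝟙 (keepʳ b) *_) (∑-occurrences-column b))) ⟩
    1 + 𝟙 (keepʳ b) * indegree b
      ≤⟨ kept ⟩
    Δ ∎
    where
    open ≤-Reasoning
    first : ∀ x y → 𝟙 (x ∧ y) ≤ 𝟙 x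
    first true  y = 𝟙≤1 y
    first false y = z≤n
    second : ∀ x y m → 𝟙 ((x ∧ y) ∧ (0 <ᵇ m)) ≤ 𝟙 y * m
    second false y     m = z≤n
    second true  false m = z≤n
    second true  true  m = ≤-trans (𝟙-positive-≤ m) (≤-reflexive (sym (+-identityʳ m)))
    kept : 1 + 𝟙 (keepʳ b) * indegree b ≤ Δ
    kept with indegree b <ᵇ Δ in eq
    ... | true  = ≤-trans (≤-reflexive (cong suc (+-identityʳ _))) (≡true⇒< eq)
    ... | false = 0<Δ

  few-large : ∀ (f : Fin n → ℕ) → ∑ (allFin n) f ≡ length es →
    Δ * ∑ (allFin n) (λ a → 𝟙 (not (f a <ᵇ Δ))) ≤ length es
  few-large f total = begin
    Δ * ∑ (allFin n) (λ a → 𝟙 (not (f a <ᵇ Δ)))  ≡⟨ ∑-*ˡ (allFin n) Δ ⟨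
    ∑ (allFin n) (λ a → Δ * 𝟙 (not (f a <ᵇ Δ)))  ≤⟨ ∑-mono (allFin n) large ⟩
    ∑ (allFin n) f                               ≡⟨ total ⟩
    length es                                    ∎
    where
    open ≤-Reasoning
    large : ∀ a → Δ * 𝟙 (not (f a <ᵇ Δ)) ≤ f a
    large a with f a <? Δ
    ... | yes lt rewrite <⇒≡true lt | *-zeroʳ Δ = z≤n
    ... | no  ge with f a <ᵇ Δ in eq
    ...   | true  = contradiction (≡true⇒< eq) ge
    ...   | false rewrite *-identityʳ Δ = ≮⇒≥ ge

  ∑-outdegree : ∑ (allFin n) outdegree ≡ length es
  ∑-outdegree = trans (∑-swap (allFin n) es) (trans (∑-cong es λ e → trans (∑-cong (allFin n) λ a → sym (+-identityʳ _)) (∑-δ (proj₁ e) (λ _ → 1))) (sym (length-∑ es)))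

  ∑-indegree : ∑ (allFin n) indegree ≡ length es
  ∑-indegree = trans (∑-swap (allFin n) es) (trans (∑-cong es λ e → trans (∑-cong (allFin n) λ a → sym (+-identityʳ _)) (∑-δ (proj₂ e) (λ _ → 1))) (sym (length-∑ es)))

  module _ {d : ℕ} (0<d : 0 < d) (1000d≤Δ : 1000 * d ≤ Δ) (1000≤n : 1000 ≤ n) (len : length es ≡ d * n) where

    few : ∀ (f : Fin n → ℕ) → ∑ (allFin n) f ≡ length es → 1000 * ∑ (allFin n) (λ a → 𝟙 (not (f a <ᵇ Δ))) ≤ n
    few f total = *-cancelˡ-≤ d {{>-nonZero 0<d}} (begin
      d * (1000 * bad)  ≡⟨ trans (sym (*-assoc d 1000 bad)) (cong (_* bad) (*-comm d 1000)) ⟩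
      1000 * d * bad    ≤⟨ *-monoˡ-≤ bad 1000d≤Δ ⟩
      Δ * bad           ≤⟨ few-large f total ⟩
      length es         ≡⟨ len ⟩
      d * n             ∎)
      where
      open ≤-Reasoning
      bad = ∑ (allFin n) (λ a → 𝟙 (not (f a <ᵇ Δ)))

    most : ∀ (P keep : Fin n → Bool) → 1000 * ∑ (allFin n) (λ a → 𝟙 (not (keep a))) ≤ 2 * n →
      1000 * ∑ (allFin n) (𝟙 ∘ P) ≤ 1000 * ∑ (allFin n) (λ a → 𝟙 (P a ∧ keep a)) + 2 * n
    most P keep lost = begin
      1000 * ∑ (allFin n) (𝟙 ∘ P)
        ≤⟨ *-monoʳ-≤ 1000 (∑-mono (allFin n) λ a → kept-or-lost (P a) (keep a)) ⟩
      1000 * ∑ (allFin n) (λ a → 𝟙 (P a ∧ keep a) + 𝟙 (not (keep a)))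
        ≡⟨ cong (1000 *_) (∑-+ (allFin n)) ⟩
      1000 * (∑ (allFin n) (λ a → 𝟙 (P a ∧ keep a)) + ∑ (allFin n) (λ a → 𝟙 (not (keep a))))
        ≡⟨ *-distribˡ-+ 1000 (∑ (allFin n) (λ a → 𝟙 (P a ∧ keep a))) _ ⟩
      1000 * ∑ (allFin n) (λ a → 𝟙 (P a ∧ keep a)) + 1000 * ∑ (allFin n) (λ a → 𝟙 (not (keep a)))
        ≤⟨ +-monoʳ-≤ (1000 * ∑ (allFin n) (λ a → 𝟙 (P a ∧ keep a))) lost ⟩
      1000 * ∑ (allFin n) (λ a → 𝟙 (P a ∧ keep a)) + 2 * n ∎
      where
      open ≤-Reasoning
      kept-or-lost : ∀ p k → 𝟙 p ≤ 𝟙 (p ∧ k) + 𝟙 (not k)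
      kept-or-lost false k     = z≤n
      kept-or-lost true  true  = ≤-refl
      kept-or-lost true  false = ≤-refl

    -- The mean degree is d and Δ ≥ 1000 d, so at most n / 1000 vertices have outdegree Δ or more.
    -- Vertex 0 is lost as well, and `1000 ≤ n` counts it as another n / 1000; hence `2 * n`.
    mostˡ : ∀ (P : Fin n → Bool) → 1000 * ∑ (allFin n) (𝟙 ∘ P) ≤ 1000 * ∑ (allFin n) (λ a → 𝟙 (P a ∧ keepˡ a)) + 2 * n
    mostˡ P = most P keepˡ (begin
      1000 * ∑ (allFin n) (λ a → 𝟙 (not (keepˡ a)))
        ≤⟨ *-monoʳ-≤ 1000 (∑-mono (allFin n) λ a → de-morgan (0 <ᵇ toℕ a) (outdegree a <ᵇ Δ)) ⟩
      1000 * ∑ (allFin n) (λ a → 𝟙 (not (0 <ᵇ toℕ a)) + 𝟙 (not (outdegree a <ᵇ Δ)))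
        ≡⟨ trans (cong (1000 *_) (∑-+ (allFin n))) (*-distribˡ-+ 1000 (∑ (allFin n) (λ a → 𝟙 (not (0 <ᵇ toℕ a)))) _) ⟩
      1000 * ∑ (allFin n) (λ a → 𝟙 (not (0 <ᵇ toℕ a))) + 1000 * ∑ (allFin n) (λ a → 𝟙 (not (outdegree a <ᵇ Δ)))
        ≤⟨ +-mono-≤ (≤-trans (*-monoʳ-≤ 1000 ∑-vertex-0) 1000≤n) (few outdegree ∑-outdegree) ⟩
      n + n
        ≡⟨ cong (n +_) (+-identityʳ n) ⟨
      2 * n ∎)
      where
      open ≤-Reasoning
      de-morgan : ∀ x y → 𝟙 (not (x ∧ y)) ≤ 𝟙 (not x) + 𝟙 (not y)
      de-morgan false y = s≤s z≤n
      de-morgan true  y = ≤-refl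

    mostʳ : ∀ (P : Fin n → Bool) → 1000 * ∑ (allFin n) (𝟙 ∘ P) ≤ 1000 * ∑ (allFin n) (λ b → 𝟙 (P b ∧ keepʳ b)) + 2 * n
    mostʳ P = most P keepʳ (≤-trans (few indegree ∑-indegree) (m≤m+n n (n + 0)))

-- The blown-up tournament and the block assignment of a copy.

module Blowup {M k : ℕ} (block : Fin M → Fin k) (g : Fin k → Fin k → Bool) where

  orient : Fin M → Fin M → Bool
  orient u v with <-cmp (toℕ (block u)) (toℕ (block v))
  ... | tri< _ _ _ = g (block u) (block v)
  ... | tri> _ _ _ = not (g (block v) (block u))
  -- Transitive inside a block. As `against` is false on the diagonal, pairs sent into one block
  -- never count as hits.
  ... | tri≈ _ _ _ = toℕ u <ᵇ toℕ v

  tournament : Digraph (Fin M)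
  tournament = record { edge = orient ; loopless = irreflexive }
    where
    irreflexive : ∀ u → ¬ T (orient u u)
    irreflexive u e with <-cmp (toℕ (block u)) (toℕ (block u))
    ... | tri< lt _ _ = <-irrefl refl lt
    ... | tri> _ _ gt = <-irrefl refl gt
    ... | tri≈ _ _ _  = <-irrefl refl (<ᵇ⇒< (toℕ u) (toℕ u) e)

  isTournament : IsTournament tournament
  isTournament u v u≢v with <-cmp (toℕ (block u)) (toℕ (block v)) | <-cmp (toℕ (block v)) (toℕ (block u))
  ... | tri< _ _ _  | tri> _ _ _  = sym (not-involutive _)
  ... | tri> _ _ _  | tri< _ _ _  = refl
  ... | tri≈ _ _ _  | tri≈ _ _ _  = total (toℕ u) (toℕ v) (u≢v ∘ Fin.toℕ-injective)
    where
    total : ∀ x y → x ≢ y → (x <ᵇ y) ≡ not (y <ᵇ x)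
    total zero    zero    x≢y = contradiction refl x≢y
    total zero    (suc y) x≢y = refl
    total (suc x) zero    x≢y = refl
    total (suc x) (suc y) x≢y = total x y (x≢y ∘ cong suc)
  ... | tri< lt _ _ | tri< gt _ _ = contradiction gt (<-asym lt)
  ... | tri> _ _ gt | tri> _ _ lt = contradiction gt (<-asym lt)
  ... | tri< _ ne _ | tri≈ _ eq _ = contradiction (sym eq) ne
  ... | tri> _ ne _ | tri≈ _ eq _ = contradiction (sym eq) ne
  ... | tri≈ _ eq _ | tri< _ ne _ = contradiction (sym eq) ne
  ... | tri≈ _ eq _ | tri> _ ne _ = contradiction (sym eq) ne

  against⇒¬edge : ∀ u v → against g (block u) (block v) ≡ true → ¬ T (orient u v)
  against⇒¬edge u v hit e with <-cmp (toℕ (block u)) (toℕ (block v))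
  ... | tri≈ _ eq _ rewrite Fin.toℕ-injective eq = diagonal (block v) hit
    where
    diagonal : ∀ i → against g i i ≢ true
    diagonal i hit with toℕ i <ᵇ toℕ i in eq
    ... | true = <-irrefl refl (≡true⇒< {toℕ i} eq)
    diagonal i () | false
  ... | tri< lt _ ¬gt with toℕ (block v) <ᵇ toℕ (block u) in eq
  ...   | true = ¬gt (≡true⇒< eq)
  ...   | false with g (block u) (block v)
  ...     | true rewrite <⇒≡true lt with () ← hit
  against⇒¬edge u v hit e | tri> ¬lt _ gt with toℕ (block u) <ᵇ toℕ (block v) in eq
  ...   | true = ¬lt (≡true⇒< eq)
  ...   | false with g (block v) (block u)
  ...     | false rewrite <⇒≡true gt with () ← hit

module Embedding {N M : ℕ} {D : Digraph (Fin N)} {S : Subset N} {R : Digraph (Fin M)} (copy : Copy (D [ S ]) R) where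

  private
    K = proj₁ copy
    iso = proj₂ (proj₂ (proj₂ copy))
    image : ⟦ S ⟧ → ⟦ K ⟧
    image = Inverse.to (proj₁ iso)

    ⟦⟧-≡ : ∀ {N} {S : Subset N} {x y : ⟦ S ⟧} → proj₁ x ≡ proj₁ y → x ≡ y
    ⟦⟧-≡ {x = _ , p} {y = _ , q} refl = cong (_ ,_) ([]=-irrelevant p q)

  -- A partial map on all vertices instead of an injection of the subtype `⟦ S ⟧`, so that its
  -- composite with `block` is an assignment in the sense of `hits`.
  embed : Fin N → Maybe (Fin M)
  embed u with u ∈? S
  ... | yes u∈ = just (proj₁ (image (u , u∈)))
  ... | no  _  = nothing

  embed-just : ∀ {u x} → embed u ≡ just x → ∃ λ u∈ → proj₁ (image (u , u∈)) ≡ x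
  embed-just {u} eq with u ∈? S
  ... | yes u∈ = u∈ , just-injective eq

  embed-∈ : ∀ {u} → u Subset.∈ S → ∃ λ x → embed u ≡ just x
  embed-∈ {u} u∈ with u ∈? S
  ... | yes _  = _ , refl
  ... | no  u∉ = contradiction u∈ u∉

  embed-injective : ∀ {u v x} → embed u ≡ just x → embed v ≡ just x → u ≡ v
  embed-injective {u} {v} p q with u∈ , eq ← embed-just {u} p | v∈ , eq′ ← embed-just {v} q =
    cong proj₁ (injective (⟦⟧-≡ (trans eq (sym eq′))))
    where
    injective : image (u , u∈) ≡ image (v , v∈) → (u , u∈) ≡ (v , v∈)
    injective h = trans (sym (Inverse.strictlyInverseʳ (proj₁ iso) (u , u∈)))
      (trans (cong (Inverse.from (proj₁ iso)) h) (Inverse.strictlyInverseʳ (proj₁ iso) (v , v∈)))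

  embed-edge : ∀ {u v x y} → embed u ≡ just x → embed v ≡ just y → Edge D u v → Edge R x y
  embed-edge {u} {v} p q e with u∈ , refl ← embed-just {u} p | v∈ , refl ← embed-just {v} q =
    proj₁ (proj₂ (proj₂ copy)) _ _ (Equivalence.to (proj₂ iso (u , u∈) (v , v∈)) e)

∑-inject≤ : ∀ M L (le : M ≤ L) (f : Fin L → ℕ) → ∑ (allFin M) (λ i → f (inject≤ i le)) ≤ ∑ (allFin L) f
∑-inject≤ zero    L       le f = z≤n
∑-inject≤ (suc M) (suc L) le f = begin
  ∑ (allFin (suc M)) (λ i → f (inject≤ i le))                  ≡⟨ ∑-suc (λ i → f (inject≤ i le)) ⟩
  f zero + ∑ (allFin M) (λ i → f (suc (inject≤ i (≤-pred le)))) ≤⟨ +-monoʳ-≤ (f zero) (∑-inject≤ M L (≤-pred le) (f ∘ suc)) ⟩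
  f zero + ∑ (allFin L) (f ∘ suc)                              ≡⟨ ∑-suc f ⟨
  ∑ (allFin (suc L)) f                                         ∎
  where open ≤-Reasoning

∑-combine : ∀ k s (f : Fin (k * s) → ℕ) →
  ∑ (allFin (k * s)) f ≡ ∑ (allFin k) (λ i → ∑ (allFin s) (λ j → f (combine i j)))
∑-combine zero    s f = refl
∑-combine (suc k) s f = trans (∑-↑ s (k * s) f)
  (trans (cong (∑ (allFin s) (λ j → f (j ↑ˡ k * s)) +_) (∑-combine k s (λ z → f (s ↑ʳ z))))
         (sym (∑-suc {k} (λ i → ∑ (allFin s) (λ j → f (combine i j))))))

does-≟-sym : ∀ (i j : Fin k) → does (i Fin.≟ j) ≡ does (j Fin.≟ i)
does-≟-sym i j with i Fin.≟ j
... | yes refl = sym (dec-true (i Fin.≟ i) refl)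
... | no  i≢j  = sym (dec-false (j Fin.≟ i) (i≢j ∘ sym))

module Blocks {M k s : ℕ} (M≤ks : M ≤ k * s) where

  block : Fin M → Fin k
  block u = quotient s (inject≤ u M≤ks)

  block-size : ∀ i → ∑ (allFin M) (λ u → 𝟙 (does (block u Fin.≟ i))) ≤ s
  block-size i = begin
    ∑ (allFin M) (λ u → 𝟙 (does (block u Fin.≟ i)))
      ≤⟨ ∑-inject≤ M (k * s) M≤ks (λ z → 𝟙 (does (quotient {k} s z Fin.≟ i))) ⟩
    ∑ (allFin (k * s)) (λ z → 𝟙 (does (quotient {k} s z Fin.≟ i)))
      ≡⟨ ∑-combine k s (λ z → 𝟙 (does (quotient {k} s z Fin.≟ i))) ⟩
    ∑ (allFin k) (λ i′ → ∑ (allFin s) (λ j → 𝟙 (does (quotient {k} s (combine i′ j) Fin.≟ i))))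
      ≡⟨ ∑-cong (allFin k) (λ i′ → trans (∑-cong (allFin s) λ j → cong 𝟙 (trans
           (cong (λ z → does (proj₁ z Fin.≟ i)) (Fin.remQuot-combine i′ j)) (does-≟-sym i′ i)))
           (∑-allFin-const s _)) ⟩
    ∑ (allFin k) (λ i′ → s * 𝟙 (does (i Fin.≟ i′)))
      ≡⟨ ∑-δ i (λ _ → s) ⟩
    s ∎
    where open ≤-Reasoning

∑-unique : (f : Fin n → ℕ) → (∀ a → f a ≤ 1) → (∀ a a′ → 0 < f a → 0 < f a′ → a ≡ a′) → ∑ (allFin n) f ≤ 1
∑-unique {zero}  f f≤1 unique = z≤n
∑-unique {suc n} f f≤1 unique with f zero ≟ 0
... | yes eq = begin
  ∑ (allFin (suc n)) f            ≡⟨ ∑-suc f ⟩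
  f zero + ∑ (allFin n) (f ∘ suc) ≡⟨ cong (_+ ∑ (allFin n) (f ∘ suc)) eq ⟩
  ∑ (allFin n) (f ∘ suc)          ≤⟨ ∑-unique (f ∘ suc) (f≤1 ∘ suc) (λ a a′ p q → Fin.suc-injective (unique _ _ p q)) ⟩
  1                               ∎
  where open ≤-Reasoning
... | no f0≢0 = begin
  ∑ (allFin (suc n)) f            ≡⟨ ∑-suc f ⟩
  f zero + ∑ (allFin n) (f ∘ suc) ≡⟨ cong (f zero +_) (trans (∑-cong (allFin n) vanish) (∑-zero n)) ⟩
  f zero + 0                      ≡⟨ +-identityʳ _ ⟩
  f zero                          ≤⟨ f≤1 zero ⟩
  1                               ∎
  where
  open ≤-Reasoning
  vanish : ∀ a → f (suc a) ≡ 0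
  vanish a with f (suc a) in eq′
  ... | zero  = refl
  ... | suc y with () ← unique zero (suc a) (n≢0⇒n>0 f0≢0) (subst (0 <_) (sym eq′) (s≤s z≤n))

multiplicity-injective : ∀ {M} (emb : Fin n → Maybe (Fin M)) →
  (∀ {a a′ x} → emb a ≡ just x → emb a′ ≡ just x → a ≡ a′) →
  ∀ y → multiplicity (mapMaybe emb (allFin n)) y ≤ 1
multiplicity-injective {n} {M} emb injective y =
  ≤-trans (≤-reflexive (∑-mapMaybe emb (allFin n))) (∑-unique at-y ≤1 (λ a a′ p q → injective (positive a p) (positive a′ q)))
  where
  at-y : Fin n → ℕ
  at-y a = maybe′ (λ x → 𝟙 (does (x Fin.≟ y))) 0 (emb a)
  ≤1 : ∀ a → at-y a ≤ 1
  ≤1 a with emb a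
  ... | just x  = 𝟙≤1 _
  ... | nothing = z≤n
  positive : ∀ a → 0 < at-y a → emb a ≡ just y
  positive a p with emb a
  ... | just x with x Fin.≟ y
  ...   | yes refl = refl

-- Each vertex of R is used at most once and each block has at most s of them. This is all that the
-- passage to blocks retains of injectivity.
multiplicity-block : ∀ {M s} (block : Fin M → Fin k) → (∀ i → ∑ (allFin M) (λ u → 𝟙 (does (block u Fin.≟ i))) ≤ s) →
  (emb : Fin n → Maybe (Fin M)) → (∀ {a a′ x} → emb a ≡ just x → emb a′ ≡ just x → a ≡ a′) →
  ∀ i → multiplicity (map block (mapMaybe emb (allFin n))) i ≤ s
multiplicity-block {k} {n} {M} {s} block size emb injective i = begin
  multiplicity (map block us) i
    ≡⟨ ∑-map block us ⟩
  ∑ us (λ u → 𝟙 (does (block u Fin.≟ i)))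
    ≡⟨ ∑-by-value us (λ u → 𝟙 (does (block u Fin.≟ i))) ⟩
  ∑ (allFin M) (λ u → 𝟙 (does (block u Fin.≟ i)) * multiplicity us u)
    ≤⟨ ∑-mono (allFin M) (λ u → ≤-trans (*-monoʳ-≤ (𝟙 (does (block u Fin.≟ i))) (multiplicity-injective emb injective u)) (≤-reflexive (*-identityʳ _))) ⟩
  ∑ (allFin M) (λ u → 𝟙 (does (block u Fin.≟ i)))
    ≤⟨ size i ⟩
  s ∎
  where
  open ≤-Reasoning
  us = mapMaybe emb (allFin n)

-- A short list of edges that hits every dense assignment.

∈-allVecs : ∀ {us : List A} → (∀ x → x ∈ us) → ∀ {m} (v : Vec A m) → v ∈ allVecs us m
∈-allVecs all []      = here refl
∈-allVecs all (x ∷ v) = ∈-cartesianProductWith⁺ _∷_ (all x) (∈-allVecs all v)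

-- `nothing` stands for a vertex that lies outside A′ or B′ or has been dropped. It takes part in no
-- hit, so a pair that is hit has both ends among the surviving vertices.
againstᴹ : (Fin k → Fin k → Bool) → Maybe (Fin k) → Maybe (Fin k) → Bool
againstᴹ g (just i) (just j) = against g i j
againstᴹ g (just _) nothing  = false
againstᴹ g nothing  _        = false

hits : (Fin k → Fin k → Bool) → (φ ψ : Fin n → Maybe (Fin k)) → ℕ
hits {n = n} g φ ψ = ∑ (allFin n) λ a → ∑ (allFin n) λ b → 𝟙 (againstᴹ g (φ a) (ψ b))

hits-mapMaybe : ∀ (g : Fin k → Fin k → Bool) (φ ψ : Fin n → Maybe (Fin k)) →
  hits g φ ψ ≡ ∑ (mapMaybe φ (allFin n)) (λ i → ∑ (mapMaybe ψ (allFin n)) (λ j → 𝟙 (against g i j)))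
hits-mapMaybe {n = n} g φ ψ = sym (trans (∑-mapMaybe φ (allFin n)) (∑-cong (allFin n) row))
  where
  entry : ∀ i (q : Maybe _) → maybe′ (λ j → 𝟙 (against g i j)) 0 q ≡ 𝟙 (againstᴹ g (just i) q)
  entry i (just j) = refl
  entry i nothing  = refl
  row : ∀ a → maybe′ (λ i → ∑ (mapMaybe ψ (allFin n)) (λ j → 𝟙 (against g i j))) 0 (φ a) ≡ ∑ (allFin n) (λ b → 𝟙 (againstᴹ g (φ a) (ψ b)))
  row a with φ a
  ... | just i  = trans (∑-mapMaybe ψ (allFin n)) (∑-cong (allFin n) λ b → entry i (ψ b))
  ... | nothing = sym (∑-zero n)

-- `greedy-cover` with vertex pairs as elements and, as tests, the assignments for which a
-- proportion 1/(D+1) of all pairs are hits. The base `suc k` counts the blocks and `nothing`.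
-- Assignments are enumerated as vectors; `tabulate` carries the functions φ and ψ over to them.
hitting-edges : ∀ (g : Fin k → Fin k → Bool) n D m → 0 < n →
  suc k ^ᴺ n * suc k ^ᴺ n * D ^ᴺ m < suc D ^ᴺ m →
  ∃ λ (es : List (Fin n × Fin n)) → length es ≡ m ×
    (∀ (φ ψ : Fin n → Maybe (Fin k)) → n * n ≤ suc D * hits g φ ψ →
      ∃ λ a → ∃ λ b → (a , b) ∈ es × againstᴹ g (φ a) (ψ b) ≡ true)
hitting-edges {k} g n D m 0<n bound =
  let es , len , covers = greedy-cover pairs hit D m tests
        (subst (0 <_) (sym length-pairs) (*-mono-≤ 0<n 0<n))
        (λ {τ} τ∈ → subst (_≤ suc D * ∑ pairs (λ e → 𝟙 (hit τ e))) (sym length-pairs) (proj₂ (∈-filter⁻ dense? {xs = all-tests} τ∈)))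
        (≤-<-trans (*-monoˡ-≤ (D ^ᴺ m) length-tests) bound)
  in es , len , λ φ ψ many →
    let (a , b) , e∈ , h = covers (∈-filter⁺ dense? (∈-all-tests φ ψ) (subst (λ z → n * n ≤ suc D * z) (sym (hits-tabulate φ ψ)) many))
    in a , b , e∈ , trans (sym (hit-tabulate φ ψ a b)) h
  where
  values : List (Maybe (Fin k))
  values = nothing ∷ map just (allFin k)

  pairs = cartesianProduct (allFin n) (allFin n)
  all-tests = cartesianProduct (allVecs values n) (allVecs values n)

  hit : Vec (Maybe (Fin k)) n × Vec (Maybe (Fin k)) n → Fin n × Fin n → Bool
  hit (v , w) (a , b) = againstᴹ g (lookup v a) (lookup w b)

  dense? : ∀ τ → _
  dense? τ = n * n ≤? suc D * ∑ pairs (λ e → 𝟙 (hit τ e))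

  tests = filter dense? all-tests

  length-pairs : length pairs ≡ n * n
  length-pairs = trans (length-cartesianProduct (allFin n) (allFin n)) (cong₂ _*_ (length-tabulate {n = n} id) (length-tabulate {n = n} id))

  length-values : length values ≡ suc k
  length-values = cong suc (trans (length-map just (allFin k)) (length-tabulate {n = k} id))

  length-tests : length tests ≤ suc k ^ᴺ n * suc k ^ᴺ n
  length-tests = begin
    length tests                                             ≤⟨ length-filter dense? all-tests ⟩
    length all-tests                                         ≡⟨ length-cartesianProduct (allVecs values n) (allVecs values n) ⟩
    length (allVecs values n) * length (allVecs values n)    ≡⟨ cong (λ z → z * z) (trans (length-allVecs values n) (cong (_^ᴺ n) length-values)) ⟩
    suc k ^ᴺ n * suc k ^ᴺ n                                    ∎
    where open ≤-Reasoning

  ∈-values : ∀ x → x ∈ values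
  ∈-values nothing  = here refl
  ∈-values (just i) = there (∈-map⁺ just (∈-allFin i))

  ∈-all-tests : ∀ φ ψ → (tabulate φ , tabulate ψ) ∈ all-tests
  ∈-all-tests φ ψ = ∈-cartesianProduct⁺ (∈-allVecs ∈-values (tabulate φ)) (∈-allVecs ∈-values (tabulate ψ))

  hit-tabulate : ∀ φ ψ a b → hit (tabulate φ , tabulate ψ) (a , b) ≡ againstᴹ g (φ a) (ψ b)
  hit-tabulate φ ψ a b = cong₂ (againstᴹ g) (lookup∘tabulate φ a) (lookup∘tabulate ψ b)

  hits-tabulate : ∀ φ ψ → ∑ pairs (λ e → 𝟙 (hit (tabulate φ , tabulate ψ) e)) ≡ hits g φ ψ
  hits-tabulate φ ψ = trans (∑-cartesianProductWith _,_ (allFin n) (allFin n))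
    (∑-cong (allFin n) λ a → ∑-cong (allFin n) λ b → cong 𝟙 (hit-tabulate φ ψ a b))

against-exists : (g : Fin k → Fin k → Bool) → 2 ≤ k → ∃ λ i → ∃ λ j → against g i j ≡ true
against-exists {suc (suc k)} g _ with g zero (suc zero) in eq
... | true  = suc zero , zero , eq
... | false = zero , suc zero , cong (λ b → not b ∨ false) eq
against-exists {suc zero} g (s≤s ())

-- Proportions after truncation, and assembly of the construction.

if-just : ∀ {B : Set} b {q : Maybe B} {x} → (if b then q else nothing) ≡ just x → b ≡ true × q ≡ just x
if-just true eq = refl , eq

-- Here c counts the vertices of A′ (or B′), and x those of them that survive the truncation.
spread-room : ∀ {n c x m s q} → 98 * n ≤ 100 * c → 1000 * c ≤ 1000 * x + 2 * n →
  4 * m ≤ n → 100 * q ≤ n → s ≤ q → m + q + (m + q) + s ≤ x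
spread-room {n} {c} {x} {m} {s} {q} many kept 4m≤n 100q≤n s≤q = *-cancelˡ-≤ 1000 (begin
  1000 * (m + q + (m + q) + s)  ≤⟨ *-monoʳ-≤ 1000 (+-monoʳ-≤ (m + q + (m + q)) s≤q) ⟩
  1000 * (m + q + (m + q) + q)  ≡⟨ expand m q ⟩
  500 * (4 * m) + 30 * (100 * q) ≤⟨ +-mono-≤ (*-monoʳ-≤ 500 4m≤n) (*-monoʳ-≤ 30 100q≤n) ⟩
  -- Truncation leaves x ≥ 0.98 n - 0.002 n = 0.978 n, while 2 m + 3 q ≤ 0.53 n; 448 is the slack in
  -- thousandths of n.
  500 * n + 30 * n              ≤⟨ m≤m+n _ (448 * n) ⟩
  500 * n + 30 * n + 448 * n    ≤⟨ +-cancelʳ-≤ (2 * n) _ _ (begin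
    500 * n + 30 * n + 448 * n + 2 * n ≡⟨ collect n ⟩
    10 * (98 * n)                      ≤⟨ *-monoʳ-≤ 10 many ⟩
    10 * (100 * c)                     ≡⟨ *-assoc 10 100 c ⟨
    1000 * c                           ≤⟨ kept ⟩
    1000 * x + 2 * n                   ∎) ⟩
  1000 * x ∎)
  where
  open ≤-Reasoning
  double : ∀ m q → m + q + (m + q) + q ≡ 2 * m + 3 * q
  double = solve-∀
  expand : ∀ m q → 1000 * (m + q + (m + q) + q) ≡ 500 * (4 * m) + 30 * (100 * q)
  expand m q = trans (cong (1000 *_) (double m q)) (trans (*-distribˡ-+ 1000 (2 * m) (3 * q))
    (cong₂ _+_ (trans (sym (*-assoc 1000 2 m)) (*-assoc 500 4 m)) (trans (sym (*-assoc 1000 3 q)) (*-assoc 30 100 q))))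
  collect : ∀ n → 500 * n + 30 * n + 448 * n + 2 * n ≡ 10 * (98 * n)
  collect n = trans (cong (λ z → z + 448 * n + 2 * n) (sym (*-distribʳ-+ n 500 30)))
    (trans (cong (_+ 2 * n) (sym (*-distribʳ-+ n 530 448)))
    (trans (sym (*-distribʳ-+ n 978 2)) (*-assoc 10 98 n)))

-- 0.01 n - 0.002 n = n / 125. The square of this share dictates the size of `D`.
surviving-share : ∀ {n c x} → n ≤ 100 * c → 1000 * c ≤ 1000 * x + 2 * n → n ≤ 125 * x
surviving-share {n} {c} {x} many kept = *-cancelˡ-≤ 8 (+-cancelʳ-≤ (2 * n) _ _ (begin
  8 * n + 2 * n           ≡⟨ *-distribʳ-+ n 8 2 ⟨
  10 * n                  ≤⟨ *-monoʳ-≤ 10 many ⟩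
  10 * (100 * c)          ≡⟨ *-assoc 10 100 c ⟨
  1000 * c                ≤⟨ kept ⟩
  1000 * x + 2 * n        ≡⟨ cong (_+ 2 * n) (*-assoc 8 125 x) ⟩
  8 * (125 * x) + 2 * n   ∎))
  where
  open ≤-Reasoning

-- If x and y are at least n / r and a proportion 1/c of x * y pairs are hits, then the hits make up
-- at least 1/(r² c) of all n² pairs. Used with (r, c) = (125, 1) for constant assignments and (7,
-- 4) for copies.
square-bound : ∀ r c {n x y D h} → r * r * c ≤ D → n ≤ r * x → n ≤ r * y → x * y ≤ c * h → n * n ≤ D * h
square-bound r c {n} {x} {y} {D} {h} large n≤rx n≤ry xy≤ch = begin
  n * n              ≤⟨ *-mono-≤ n≤rx n≤ry ⟩
  r * x * (r * y)    ≡⟨ [m*n]*[o*p]≡[m*o]*[n*p] r x r y ⟩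
  r * r * (x * y)    ≤⟨ *-monoʳ-≤ (r * r) xy≤ch ⟩
  r * r * (c * h)    ≡⟨ *-assoc (r * r) c h ⟨
  r * r * c * h      ≤⟨ *-monoˡ-≤ h large ⟩
  D * h              ∎
  where open ≤-Reasoning

Pair : (n Δ M : ℕ) → Set
Pair n Δ M =
  Σ[ N ∈ ℕ ] Σ[ D₀ ∈ Digraph (Fin N) ] Σ[ A ∈ Subset N ] Σ[ B ∈ Subset N ] Σ[ R ∈ Digraph (Fin M) ]
    ( IsBipartiteFromTo D₀ A B
    × ∣ A ∣ ≡ ∣ B ∣
    × ∣ A ∣ ≤ n
    × maxDegree D₀ ≡ Δ
    × IsTournament R
    × (∀ (A′ B′ : Subset N) → A′ Subset.⊆ A → B′ Subset.⊆ B →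
        (98 * ∣ A ∣ ≤ 100 * ∣ A′ ∣ → 98 * ∣ A ∣ ≤ 100 * ∣ B′ ∣ → ¬ Copy (D₀ [ A′ ∪ B′ ]) R)
      × (∣ A ∣ ≤ 100 * ∣ A′ ∣ → ∣ A ∣ ≤ 100 * ∣ B′ ∣ → 0 < edgeCount D₀ A′ B′)))

module Construction {k n Δ M D d s t : ℕ} (g : Fin k → Fin k → Bool) (2≤k : 2 ≤ k)
  (dense : ∀ c → Dense t (λ i j → c xor g i j)) (0<t : 0 < t) (0<s : 0 < s) (100st≤n : 100 * (s * t) ≤ n)
  (M≤ks : M ≤ k * s) (D-large : 125 * 125 * 1 ≤ suc D) (0<d : 0 < d) (1000d≤Δ : 1000 * d ≤ Δ) (Δ≤n : Δ ≤ n)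
  (es : List (Fin n × Fin n)) (len : length es ≡ d * n)
  (covers : ∀ (φ ψ : Fin n → Maybe (Fin k)) → n * n ≤ suc D * hits g φ ψ →
    ∃ λ a → ∃ λ b → (a , b) ∈ es × againstᴹ g (φ a) (ψ b) ≡ true) where

  1000≤n : 1000 ≤ n
  1000≤n = ≤-trans (*-monoʳ-≤ 1000 0<d) (≤-trans 1000d≤Δ Δ≤n)
  0<n : 0 < n
  0<n = ≤-trans (s≤s z≤n) 1000≤n
  0<Δ : 0 < Δ
  0<Δ = ≤-trans (s≤s z≤n) (≤-trans (*-monoʳ-≤ 1000 0<d) 1000d≤Δ)

  open Truncation n Δ es
  open Bipartite n adj
  open Blocks {M} {k} {s} M≤ks
  open Blowup block g

  module _ (A′ B′ : Subset (n + n)) (A′⊆ : A′ Subset.⊆ left) (B′⊆ : B′ Subset.⊆ right) where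

    P Q : Fin n → Bool
    P a = lookup A′ (a ↑ˡ n) ∧ keepˡ a
    Q b = lookup B′ (n ↑ʳ b) ∧ keepʳ b

    P-true : ∀ {a} → P a ≡ true → a ↑ˡ n Subset.∈ A′ × keepˡ a ≡ true
    P-true {a} eq with lookup A′ (a ↑ˡ n) in eq′
    ... | true = lookup⇒[]= (a ↑ˡ n) A′ eq′ , eq

    Q-true : ∀ {b} → Q b ≡ true → n ↑ʳ b Subset.∈ B′ × keepʳ b ≡ true
    Q-true {b} eq with lookup B′ (n ↑ʳ b) in eq′
    ... | true = lookup⇒[]= (n ↑ʳ b) B′ eq′ , eq

    survivingˡ : 1000 * ∣ A′ ∣ ≤ 1000 * ∑ (allFin n) (𝟙 ∘ P) + 2 * n
    survivingˡ = ≤-trans (≤-reflexive (cong (1000 *_) (∣∣-left A′⊆))) (mostˡ 0<d 1000d≤Δ 1000≤n len (λ a → lookup A′ (a ↑ˡ n)))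

    survivingʳ : 1000 * ∣ B′ ∣ ≤ 1000 * ∑ (allFin n) (𝟙 ∘ Q) + 2 * n
    survivingʳ = ≤-trans (≤-reflexive (cong (1000 *_) (∣∣-right B′⊆))) (mostʳ 0<d 1000d≤Δ 1000≤n len (λ b → lookup B′ (n ↑ʳ b)))

    surviving-edge : ∀ {a b} → (a , b) ∈ es → P a ≡ true → Q b ≡ true → T (edge graph (a ↑ˡ n) (n ↑ʳ b))
    surviving-edge {a} {b} e∈ Pa Qb = subst T (sym (edge-↑ a b)) (≡true⇒T (adj-∈ e∈ (proj₂ (P-true Pa)) (proj₂ (Q-true Qb))))

    some-edge : ∣ left ∣ ≤ 100 * ∣ A′ ∣ → ∣ left ∣ ≤ 100 * ∣ B′ ∣ → 0 < edgeCount graph A′ B′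
    some-edge bigA bigB =
      -- `φ` and `ψ` are `nothing` off `P` and `Q`, so the listed pair that is hit joins surviving
      -- vertices of A′ and B′.
      let i , j , ij = against-exists g 2≤k
          a , b , e∈ , h = covers (φ i) (ψ j) (enough i j ij)
          Pa , Qb = both i j a b h
      in edgeCount-positive graph (proj₁ (P-true Pa)) (proj₁ (Q-true Qb)) (surviving-edge e∈ Pa Qb)
      where
      φ ψ : Fin k → Fin n → Maybe (Fin k)
      φ i a = if P a then just i else nothing
      ψ j b = if Q b then just j else nothing
      both : ∀ i j a b → againstᴹ g (φ i a) (ψ j b) ≡ true → P a ≡ true × Q b ≡ true
      both i j a b h with P a | Q b
      ... | true | true = refl , refl
      count : ∀ i j → against g i j ≡ true → ∀ a b → 𝟙 (P a) * 𝟙 (Q b) ≡ 𝟙 (againstᴹ g (φ i a) (ψ j b))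
      count i j ij a b with P a | Q b
      ... | true  | true  = sym (cong 𝟙 ij)
      ... | true  | false = refl
      ... | false | _     = refl
      x = ∑ (allFin n) (𝟙 ∘ P)
      y = ∑ (allFin n) (𝟙 ∘ Q)
      enough : ∀ i j → against g i j ≡ true → n * n ≤ suc D * hits g (φ i) (ψ j)
      enough i j ij = square-bound 125 1 {x = x} {y = y} D-large
        (surviving-share {c = ∣ A′ ∣} {x = x} (subst (_≤ 100 * ∣ A′ ∣) ∣left∣ bigA) survivingˡ)
        (surviving-share {c = ∣ B′ ∣} {x = y} (subst (_≤ 100 * ∣ B′ ∣) ∣left∣ bigB) survivingʳ)
        (≤-reflexive (trans (sym (∑-*ʳ (allFin n) y {f = 𝟙 ∘ P})) (trans (∑-cong (allFin n) λ a →
          trans (sym (∑-*ˡ (allFin n) (𝟙 (P a)))) (∑-cong (allFin n) (count i j ij a))) (sym (*-identityˡ (hits g (φ i) (ψ j)))))))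

    no-copy : 98 * ∣ left ∣ ≤ 100 * ∣ A′ ∣ → 98 * ∣ left ∣ ≤ 100 * ∣ B′ ∣ → ¬ Copy (graph [ A′ ∪ B′ ]) tournament
    no-copy bigA bigB copy =
      -- The listed pair that is hit survives truncation, hence is an edge of D₀ inside A′ ∪ B′. The
      -- copy would send it to an edge of R from `x` to `y`, which `against` forbids.
      let a , b , e∈ , h = covers φ ψ enough
          x , y , p , q , xy = both a b h
          Pa , p′ = if-just (P a) p
          Qb , q′ = if-just (Q b) q
      in against⇒¬edge x y xy (embed-edge {a ↑ˡ n} {n ↑ʳ b} p′ q′ (surviving-edge e∈ Pa Qb))
      where
      open Embedding {D = graph} {S = A′ ∪ B′} {R = tournament} copy

      embˡ embʳ : Fin n → Maybe (Fin M)
      embˡ a = if P a then embed (a ↑ˡ n) else nothing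
      embʳ b = if Q b then embed (n ↑ʳ b) else nothing

      φ ψ : Fin n → Maybe (Fin k)
      φ a = Maybe.map block (embˡ a)
      ψ b = Maybe.map block (embʳ b)

      both : ∀ a b → againstᴹ g (φ a) (ψ b) ≡ true →
        ∃ λ x → ∃ λ y → embˡ a ≡ just x × embʳ b ≡ just y × against g (block x) (block y) ≡ true
      both a b h with embˡ a | embʳ b
      ... | just x | just y = x , y , refl , refl , h

      embˡ-injective : ∀ {a a′ x} → embˡ a ≡ just x → embˡ a′ ≡ just x → a ≡ a′
      embˡ-injective {a} {a′} p q = Fin.↑ˡ-injective n a a′
        (embed-injective (proj₂ (if-just (P a) p)) (proj₂ (if-just (P a′) q)))

      embʳ-injective : ∀ {b b′ x} → embʳ b ≡ just x → embʳ b′ ≡ just x → b ≡ b′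
      embʳ-injective {b} {b′} p q = Fin.↑ʳ-injective n b b′
        (embed-injective (proj₂ (if-just (Q b) p)) (proj₂ (if-just (Q b′) q)))

      xs = map block (mapMaybe embˡ (allFin n))
      ys = map block (mapMaybe embʳ (allFin n))

      pointˡ : ∀ a → maybe′ (λ _ → 1) 0 (embˡ a) ≡ 𝟙 (P a)
      pointˡ a with P a in eq
      ... | false = refl
      ... | true  = cong (maybe′ (λ _ → 1) 0) (proj₂ (embed-∈ (x∈p∪q⁺ {p = A′} {q = B′} (inj₁ (proj₁ (P-true eq))))))

      pointʳ : ∀ b → maybe′ (λ _ → 1) 0 (embʳ b) ≡ 𝟙 (Q b)
      pointʳ b with Q b in eq
      ... | false = refl
      ... | true  = cong (maybe′ (λ _ → 1) 0) (proj₂ (embed-∈ (x∈p∪q⁺ {p = A′} {q = B′} (inj₂ (proj₁ (Q-true eq))))))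

      length-image : ∀ (emb : Fin n → Maybe (Fin M)) (W : Fin n → Bool) → (∀ a → maybe′ (λ _ → 1) 0 (emb a) ≡ 𝟙 (W a)) →
        length (map block (mapMaybe emb (allFin n))) ≡ ∑ (allFin n) (𝟙 ∘ W)
      length-image emb W point = trans (length-map block (mapMaybe emb (allFin n)))
        (trans (length-∑ (mapMaybe emb (allFin n))) (trans (∑-mapMaybe emb (allFin n)) (∑-cong (allFin n) point)))

      -- Two portions of m + s * t and a further s must fit into 0.978 n. The remainder of n modulo
      -- 4 is at most 3 ≤ 3 m, which gives n ≤ 7 m.
      m = n / 4
      4m≤n : 4 * m ≤ n
      4m≤n = ≤-trans (≤-reflexive (*-comm 4 m)) (m/n*n≤m n 4)
      n≤7m : n ≤ 7 * m
      n≤7m = begin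
        n                  ≡⟨ m≡m%n+[m/n]*n n 4 ⟩
        n % 4 + m * 4      ≤⟨ +-monoˡ-≤ (m * 4) (≤-trans (≤-pred (m%n<n n 4)) (*-monoʳ-≤ 3 (m≥n⇒m/n>0 (≤-trans (from-yes (4 ≤? 1000)) 1000≤n)))) ⟩
        3 * m + m * 4      ≡⟨ collect m ⟩
        7 * m              ∎
        where
        open ≤-Reasoning
        collect : ∀ m → 3 * m + m * 4 ≡ 7 * m
        collect = solve-∀

      s≤st : s ≤ s * t
      s≤st = m≤m*n s t {{>-nonZero 0<t}}

      room : ∀ {c x} → 98 * ∣ left ∣ ≤ 100 * c → 1000 * c ≤ 1000 * x + 2 * n → m + s * t + (m + s * t) + s ≤ x
      room {c} {x} big kept = spread-room {c = c} {x = x} {m = m} (subst (λ z → 98 * z ≤ 100 * c) ∣left∣ big) kept 4m≤n 100st≤n s≤st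

      enough : n * n ≤ suc D * hits g φ ψ
      enough = subst (λ z → n * n ≤ suc D * z) hits-images (square-bound 7 4 {x = m} {y = m}
        (≤-trans (from-yes (7 * 7 * 4 ≤? 125 * 125 * 1)) D-large) n≤7m n≤7m
        (against-dense g {m = m} xs ys 0<s 0<t dense
          (multiplicity-block block block-size embˡ embˡ-injective)
          (multiplicity-block block block-size embʳ embʳ-injective)
          (≤-trans (≤-trans (m≤m+n _ s) (room {∣ A′ ∣} {∑ (allFin n) (𝟙 ∘ P)} bigA survivingˡ)) (≤-reflexive (sym (length-image embˡ P pointˡ))))
          (≤-trans (room {∣ B′ ∣} {∑ (allFin n) (𝟙 ∘ Q)} bigB survivingʳ) (≤-reflexive (sym (length-image embʳ Q pointʳ))))))
        where
        hits-images : ∑ xs (λ i → ∑ ys (λ j → 𝟙 (against g i j))) ≡ hits g φ ψ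
        hits-images = trans (cong₂ (λ us vs → ∑ us (λ i → ∑ vs (λ j → 𝟙 (against g i j))))
          (map-mapMaybe block embˡ (allFin n)) (map-mapMaybe block embʳ (allFin n))) (sym (hits-mapMaybe g φ ψ))

  result : Pair n Δ M
  result =
    n + n , graph , left , right , tournament ,
    graph-bipartite , trans ∣left∣ (sym ∣right∣) , ≤-reflexive ∣left∣ ,
    maxDegree-graph (adj-row-≤ Δ≤n) (adj-column-≤ 0<Δ) (fromℕ< 0<n , adj-row-0 Δ≤n (fromℕ< 0<n) (Fin.toℕ-fromℕ< 0<n)) ,
    isTournament , λ A′ B′ A′⊆ B′⊆ → no-copy A′ B′ A′⊆ B′⊆ , some-edge A′ B′ A′⊆ B′⊆

-- Powers of a ratio and the floor, reduced to naturals.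

open import Data.Integer.Base as ℤ using (+_; -[1+_])
import Data.Integer.Properties as ℤ
open import Data.Rational.Base as ℚ using (ℚ; mkℚ; 1ℚ; floor; toℚᵘ)
import Data.Rational.Properties as ℚ
open import Data.Rational.Unnormalised.Base as ℚᵘ using (ℚᵘ; mkℚᵘ; _≃_; *≡*)
import Data.Rational.Unnormalised.Properties as ℚᵘ

ι : ℕ → ℚᵘ
ι m = mkℚᵘ (+ m) 0

ι-* : ∀ a b → ι (a * b) ≃ ι a ℚᵘ.* ι b
ι-* a b = *≡* (cong (ℤ._* + 1) (ℤ.pos-* a b))

-- Stated for unnormalised rationals, where equality is cross-multiplication, because multiplication
-- in `ℚ` divides by a gcd each time.
ratio-^ : ∀ u v .{{_ : NonZero v}} m → toℚᵘ ((+ u ℚ./ v) ^ m) ℚᵘ.* ι (v ^ᴺ m) ≃ ι (u ^ᴺ m)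
ratio-^ u v@(suc v-1) zero    = *≡* refl
ratio-^ u v@(suc v-1) (suc m) = begin
  toℚᵘ (c ℚ.* c ^ m) ℚᵘ.* ι (v * v ^ᴺ m)              ≈⟨ ℚᵘ.*-cong (ℚ.toℚᵘ-homo-* c (c ^ m)) (ι-* v (v ^ᴺ m)) ⟩
  toℚᵘ c ℚᵘ.* toℚᵘ (c ^ m) ℚᵘ.* (ι v ℚᵘ.* ι (v ^ᴺ m))  ≈⟨ interchange (toℚᵘ c) (toℚᵘ (c ^ m)) (ι v) (ι (v ^ᴺ m)) ⟩
  toℚᵘ c ℚᵘ.* ι v ℚᵘ.* (toℚᵘ (c ^ m) ℚᵘ.* ι (v ^ᴺ m))  ≈⟨ ℚᵘ.*-cong base (ratio-^ u v m) ⟩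
  ι u ℚᵘ.* ι (u ^ᴺ m)                                   ≈⟨ ι-* u (u ^ᴺ m) ⟨
  ι (u * u ^ᴺ m)                                        ∎
  where
  open import Algebra.Properties.CommutativeSemigroup (CommutativeMonoid.commutativeSemigroup ℚᵘ.*-1-commutativeMonoid) using (interchange)
  open import Relation.Binary.Reasoning.Setoid ℚᵘ.≃-setoid
  c = + u ℚ./ v
  base : toℚᵘ c ℚᵘ.* ι v ≃ ι u
  base = ℚᵘ.≃-trans (ℚᵘ.*-congʳ {ι v} (ℚ.toℚᵘ-fromℚᵘ (mkℚᵘ (+ u) v-1))) (*≡* (cancel (+ u) (+ v)))
    where
    cancel : ∀ x y → x ℤ.* y ℤ.* + 1 ≡ x ℤ.* (y ℤ.* + 1)
    cancel x y = ℤ.*-assoc x y (+ 1)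

floor-≤ : ∀ q w z → 0 < z → toℚᵘ q ℚᵘ.* ι z ≃ ι w → ∃ λ m → + m ≡ floor q × m * z ≤ w
floor-≤ (mkℚ (+ a) d-1 _) w z _ (*≡* eq) = a / suc d-1 , sym (ℤ.*-identityˡ _) ,
  *-cancelʳ-≤ _ _ (suc d-1) (begin
    a / suc d-1 * z * suc d-1    ≡⟨ swap (a / suc d-1) z (suc d-1) ⟩
    a / suc d-1 * suc d-1 * z    ≤⟨ *-monoˡ-≤ z (m/n*n≤m a (suc d-1)) ⟩
    a * z                        ≡⟨ cross ⟩
    w * suc d-1                  ∎)
  where
  open ≤-Reasoning
  swap : ∀ x y z → x * y * z ≡ x * z * y
  swap = solve-∀
  cross : a * z ≡ w * suc d-1
  cross = ℤ.+-injective (trans (ℤ.pos-* a z) (trans (sym (ℤ.*-identityʳ _)) (trans eq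
    (trans (cong (λ x → + w ℤ.* + x) (*-identityʳ (suc d-1))) (sym (ℤ.pos-* w (suc d-1)))))))
floor-≤ (mkℚ -[1+ a ] d-1 _) zero    (suc z) _ (*≡* ())
floor-≤ (mkℚ -[1+ a ] d-1 _) (suc w) (suc z) _ (*≡* ())

-- The combinatorics meets the floor only through this inequality, M ≤ (u/v)^m n with denominators
-- cleared. The argument of `floor` is nonnegative, so integer division is division of naturals.
floor-ratio-^ : ∀ u v .{{_ : NonZero v}} m n →
  ∃ λ M → + M ≡ floor ((+ u ℚ./ v) ^ m ℚ.* (+ n ℚ./ 1)) × M * v ^ᴺ m ≤ u ^ᴺ m * n
floor-ratio-^ u v m n = floor-≤ (p ℚ.* (+ n ℚ./ 1)) (u ^ᴺ m * n) (v ^ᴺ m) (m^n>0 v m) (begin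
  toℚᵘ (p ℚ.* (+ n ℚ./ 1)) ℚᵘ.* ι (v ^ᴺ m)           ≈⟨ ℚᵘ.*-congʳ {ι (v ^ᴺ m)} (ℚ.toℚᵘ-homo-* p (+ n ℚ./ 1)) ⟩
  toℚᵘ p ℚᵘ.* toℚᵘ (+ n ℚ./ 1) ℚᵘ.* ι (v ^ᴺ m)       ≈⟨ xy∙z≈xz∙y (toℚᵘ p) (toℚᵘ (+ n ℚ./ 1)) (ι (v ^ᴺ m)) ⟩
  toℚᵘ p ℚᵘ.* ι (v ^ᴺ m) ℚᵘ.* toℚᵘ (+ n ℚ./ 1)       ≈⟨ ℚᵘ.*-cong (ratio-^ u v m) (ℚ.toℚᵘ-fromℚᵘ (mkℚᵘ (+ n) 0)) ⟩
  ι (u ^ᴺ m) ℚᵘ.* ι n                               ≈⟨ ι-* (u ^ᴺ m) n ⟨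
  ι (u ^ᴺ m * n)                                    ∎)
  where
  open import Algebra.Properties.CommutativeSemigroup (CommutativeMonoid.commutativeSemigroup ℚᵘ.*-1-commutativeMonoid) using (xy∙z≈xz∙y)
  open import Relation.Binary.Reasoning.Setoid ℚᵘ.≃-setoid
  p = (+ u ℚ./ v) ^ m

1<ratio : ∀ v .{{_ : NonZero v}} → 1ℚ ℚ.< + suc v ℚ./ v
1<ratio v@(suc v-1) = ℚ.toℚᵘ-cancel-< (ℚᵘ.<-respʳ-≃ (ℚᵘ.≃-sym (ℚ.toℚᵘ-fromℚᵘ (mkℚᵘ (+ suc v) v-1)))
  (ℚᵘ.*<* (ℤ.+<+ (begin-strict
    v + 0       ≡⟨ +-identityʳ v ⟩
    v           <⟨ n<1+n v ⟩
    suc v       ≡⟨ *-identityʳ (suc v) ⟨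
    suc v * 1   ∎))))
  where open ≤-Reasoning

-- Bernoulli-type estimates and the count of assignments.

^-distribʳ-* : ∀ x y m → (x * y) ^ᴺ m ≡ x ^ᴺ m * y ^ᴺ m
^-distribʳ-* x y zero    = refl
^-distribʳ-* x y (suc m) = trans (cong (x * y *_) (^-distribʳ-* x y m)) ([m*n]*[o*p]≡[m*o]*[n*p] x y (x ^ᴺ m) (y ^ᴺ m))

-- (1 + 1/x)^j ≤ x / (x − j)
bernoulli : ∀ x j r → j + r ≡ x → suc x ^ᴺ j * r ≤ x ^ᴺ j * x
bernoulli x zero    r refl = ≤-refl
bernoulli x (suc j) r eq = begin
  suc x * suc x ^ᴺ j * r         ≡⟨ rearrange (suc x) (suc x ^ᴺ j) r ⟩
  suc x ^ᴺ j * (suc x * r)       ≤⟨ *-monoʳ-≤ (suc x ^ᴺ j) (≤-trans (+-monoˡ-≤ (x * r) (subst (r ≤_) eq (m≤n+m r (suc j)))) (≤-reflexive (sym (*-suc x r)))) ⟩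
  suc x ^ᴺ j * (x * suc r)       ≡⟨ rearrange′ (suc x ^ᴺ j) x (suc r) ⟩
  x * (suc x ^ᴺ j * suc r)       ≤⟨ *-monoʳ-≤ x (bernoulli x j (suc r) (trans (+-suc j r) eq)) ⟩
  x * (x ^ᴺ j * x)               ≡⟨ *-assoc x (x ^ᴺ j) x ⟨
  x * x ^ᴺ j * x                 ∎
  where
  open ≤-Reasoning
  rearrange : ∀ a b c → a * b * c ≡ b * (a * c)
  rearrange = solve-∀
  rearrange′ : ∀ a b c → a * (b * c) ≡ b * (a * c)
  rearrange′ = solve-∀

-- `bernoulli` with j = r = x/2 gives (1 + 1/x)^(x/2) ≤ 2, which is squared. The halving is why the
-- base has the form `y + y`.
[1+1/x]^x≤4 : ∀ y .{{_ : NonZero y}} → suc (y + y) ^ᴺ (y + y) ≤ 4 * (y + y) ^ᴺ (y + y)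
[1+1/x]^x≤4 y = begin
  suc x ^ᴺ (y + y)               ≡⟨ ^-distribˡ-+-* (suc x) y y ⟩
  suc x ^ᴺ y * suc x ^ᴺ y         ≤⟨ *-mono-≤ half half ⟩
  2 * x ^ᴺ y * (2 * x ^ᴺ y)       ≡⟨ [m*n]*[o*p]≡[m*o]*[n*p] 2 (x ^ᴺ y) 2 (x ^ᴺ y) ⟩
  4 * (x ^ᴺ y * x ^ᴺ y)           ≡⟨ cong (4 *_) (^-distribˡ-+-* x y y) ⟨
  4 * x ^ᴺ (y + y)               ∎
  where
  open ≤-Reasoning
  x = y + y
  double : ∀ a y → a * (y + y) ≡ 2 * a * y
  double = solve-∀
  half : suc x ^ᴺ y ≤ 2 * x ^ᴺ y
  half = *-cancelʳ-≤ _ _ y (≤-trans (bernoulli x y y refl) (≤-reflexive (double (x ^ᴺ y) y)))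

double-nonZero : ∀ y .{{_ : NonZero y}} → NonZero (y + y)
double-nonZero (suc y) = _

-- The exponent Δ is padded to x * b, where (1 + 1/x)^(x b) ≤ 4^b; the padding multiplies by a
-- factor of at least 1. With x = X this bounds c′^Δ.
growth : ∀ y .{{_ : NonZero y}} Δ b → Δ ≤ (y + y) * b → suc (y + y) ^ᴺ Δ ≤ 4 ^ᴺ b * (y + y) ^ᴺ Δ
growth y Δ b le with r , eq ← m≤n⇒∃[o]m+o≡n le = *-cancelʳ-≤ _ _ (x ^ᴺ r) {{m^n≢0 x r {{double-nonZero y}}}} (begin
  suc x ^ᴺ Δ * x ^ᴺ r        ≤⟨ *-monoʳ-≤ (suc x ^ᴺ Δ) (^-monoˡ-≤ r (n≤1+n x)) ⟩
  suc x ^ᴺ Δ * suc x ^ᴺ r    ≡⟨ ^-distribˡ-+-* (suc x) Δ r ⟨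
  suc x ^ᴺ (Δ + r)          ≡⟨ cong (suc x ^ᴺ_) eq ⟩
  suc x ^ᴺ (x * b)          ≡⟨ ^-*-assoc (suc x) x b ⟨
  (suc x ^ᴺ x) ^ᴺ b          ≤⟨ ^-monoˡ-≤ b ([1+1/x]^x≤4 y) ⟩
  (4 * x ^ᴺ x) ^ᴺ b          ≡⟨ ^-distribʳ-* 4 (x ^ᴺ x) b ⟩
  4 ^ᴺ b * (x ^ᴺ x) ^ᴺ b      ≡⟨ cong (4 ^ᴺ b *_) (^-*-assoc x x b) ⟩
  4 ^ᴺ b * x ^ᴺ (x * b)      ≡⟨ cong (λ z → 4 ^ᴺ b * x ^ᴺ z) eq ⟨
  4 ^ᴺ b * x ^ᴺ (Δ + r)      ≡⟨ cong (4 ^ᴺ b *_) (^-distribˡ-+-* x Δ r) ⟩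
  4 ^ᴺ b * (x ^ᴺ Δ * x ^ᴺ r)  ≡⟨ *-assoc (4 ^ᴺ b) (x ^ᴺ Δ) (x ^ᴺ r) ⟨
  4 ^ᴺ b * x ^ᴺ Δ * x ^ᴺ r    ∎)
  where
  open ≤-Reasoning
  x = y + y

-- (1 + 1/x)^m ≥ 1 + m/x
bernoulli′ : ∀ x m → x ^ᴺ m * (x + m) ≤ x * suc x ^ᴺ m
bernoulli′ x zero    = ≤-reflexive (trans (*-identityˡ (x + 0)) (trans (+-identityʳ x) (sym (*-identityʳ x))))
bernoulli′ x (suc m) = begin
  x * x ^ᴺ m * (x + suc m)            ≤⟨ m≤m+n _ (x ^ᴺ m * m) ⟩
  x * x ^ᴺ m * (x + suc m) + x ^ᴺ m * m ≡⟨ factor x m (x ^ᴺ m) ⟩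
  suc x * (x ^ᴺ m * (x + m))          ≤⟨ *-monoʳ-≤ (suc x) (bernoulli′ x m) ⟩
  suc x * (x * suc x ^ᴺ m)            ≡⟨ rearrange (suc x) x (suc x ^ᴺ m) ⟩
  x * (suc x * suc x ^ᴺ m)            ∎
  where
  open ≤-Reasoning
  factor : ∀ x m p → x * p * (x + suc m) + p * m ≡ suc x * (p * (x + m))
  factor = solve-∀
  rearrange : ∀ a b c → a * (b * c) ≡ b * (a * c)
  rearrange = solve-∀

-- (1 + 1/D)^D ≥ 2: D greedy choices at least halve the number of assignments not yet hit.
doubling : ∀ D .{{_ : NonZero D}} → 2 * D ^ᴺ D ≤ suc D ^ᴺ D
doubling D = *-cancelˡ-≤ D (≤-trans (≤-reflexive (double D (D ^ᴺ D))) (bernoulli′ D D))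
  where
  double : ∀ x p → x * (2 * p) ≡ p * (x + x)
  double = solve-∀

-- With k = 2^(4b) and k + 1 ≤ 2k there are at most 2^((8b + 2) n) assignments, fewer than 2^(9bn)
-- as b ≥ 3. At D edges per halving, D * 9b * n edges suffice, an average of 9Db per vertex of
-- either side.
counting-bound : ∀ D .{{_ : NonZero D}} b n → 3 ≤ b → 0 < n →
  suc (2 ^ᴺ (4 * b)) ^ᴺ n * suc (2 ^ᴺ (4 * b)) ^ᴺ n * D ^ᴺ (D * (9 * b) * n) < suc D ^ᴺ (D * (9 * b) * n)
counting-bound D b n 3≤b 0<n = begin-strict
  suc K ^ᴺ n * suc K ^ᴺ n * D ^ᴺ (D * (9 * b) * n)
    ≤⟨ *-monoˡ-≤ (D ^ᴺ (D * (9 * b) * n)) (*-mono-≤ small small) ⟩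
  2 ^ᴺ (suc (4 * b) * n) * 2 ^ᴺ (suc (4 * b) * n) * D ^ᴺ (D * (9 * b) * n)
    ≡⟨ cong (_* D ^ᴺ (D * (9 * b) * n)) (^-distribˡ-+-* 2 (suc (4 * b) * n) (suc (4 * b) * n)) ⟨
  2 ^ᴺ (suc (4 * b) * n + suc (4 * b) * n) * D ^ᴺ (D * (9 * b) * n)
    <⟨ *-monoˡ-< (D ^ᴺ (D * (9 * b) * n)) {{m^n≢0 D (D * (9 * b) * n)}} (^-monoʳ-< 2 (s≤s (s≤s z≤n)) exponent) ⟩
  2 ^ᴺ (9 * b * n) * D ^ᴺ (D * (9 * b) * n)
    ≡⟨ cong (λ z → 2 ^ᴺ (9 * b * n) * D ^ᴺ z) (*-assoc D (9 * b) n) ⟩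
  2 ^ᴺ (9 * b * n) * D ^ᴺ (D * (9 * b * n))
    ≡⟨ cong (2 ^ᴺ (9 * b * n) *_) (^-*-assoc D D (9 * b * n)) ⟨
  2 ^ᴺ (9 * b * n) * (D ^ᴺ D) ^ᴺ (9 * b * n)
    ≡⟨ ^-distribʳ-* 2 (D ^ᴺ D) (9 * b * n) ⟨
  (2 * D ^ᴺ D) ^ᴺ (9 * b * n)
    ≤⟨ ^-monoˡ-≤ (9 * b * n) (doubling D) ⟩
  (suc D ^ᴺ D) ^ᴺ (9 * b * n)
    ≡⟨ ^-*-assoc (suc D) D (9 * b * n) ⟩
  suc D ^ᴺ (D * (9 * b * n))
    ≡⟨ cong (suc D ^ᴺ_) (*-assoc D (9 * b) n) ⟨
  suc D ^ᴺ (D * (9 * b) * n) ∎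
  where
  open ≤-Reasoning
  K = 2 ^ᴺ (4 * b)
  small : suc K ^ᴺ n ≤ 2 ^ᴺ (suc (4 * b) * n)
  small = ≤-trans (^-monoˡ-≤ n (≤-trans (+-monoˡ-≤ K (m^n>0 2 (4 * b))) (≤-reflexive (cong (λ z → K + z) (sym (+-identityʳ K))))))
    (≤-reflexive (^-*-assoc 2 (suc (4 * b)) n))
  exponent : suc (4 * b) * n + suc (4 * b) * n < 9 * b * n
  exponent = begin-strict
    suc (4 * b) * n + suc (4 * b) * n  ≡⟨ collect b n ⟩
    2 * n + 8 * b * n                  <⟨ +-monoˡ-< (8 * b * n) (*-monoˡ-< n {{>-nonZero 0<n}} 3≤b) ⟩
    b * n + 8 * b * n                  ≡⟨ collect′ b n ⟩
    9 * b * n                          ∎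
    where
    collect : ∀ b n → suc (4 * b) * n + suc (4 * b) * n ≡ 2 * n + 8 * b * n
    collect = solve-∀
    collect′ : ∀ b n → b * n + 8 * b * n ≡ 9 * b * n
    collect′ = solve-∀

-- Choice of the parameters.

linear-≤-4^ : ∀ c b₀ j → 1 ≤ b₀ → c * b₀ ≤ 4 ^ᴺ b₀ → c * (b₀ + j) ≤ 4 ^ᴺ (b₀ + j)
linear-≤-4^ c b₀ zero    1≤b₀ base = subst (λ z → c * z ≤ 4 ^ᴺ z) (sym (+-identityʳ b₀)) base
linear-≤-4^ c b₀ (suc j) 1≤b₀ base = subst (λ z → c * z ≤ 4 ^ᴺ z) (sym (+-suc b₀ j)) (begin
  c * suc (b₀ + j)           ≤⟨ *-monoʳ-≤ c (+-monoˡ-≤ (b₀ + j) (≤-trans 1≤b₀ (m≤m+n b₀ j))) ⟩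
  c * (b₀ + j + (b₀ + j))    ≤⟨ m≤m+n _ (c * (b₀ + j + (b₀ + j))) ⟩
  c * (b₀ + j + (b₀ + j)) + c * (b₀ + j + (b₀ + j))  ≡⟨ quadruple c (b₀ + j) ⟩
  4 * (c * (b₀ + j))         ≤⟨ *-monoʳ-≤ 4 (linear-≤-4^ c b₀ j 1≤b₀ base) ⟩
  4 * 4 ^ᴺ (b₀ + j)           ∎)
  where
  open ≤-Reasoning
  quadruple : ∀ c z → c * (z + z) + c * (z + z) ≡ 4 * (c * z)
  quadruple = solve-∀

-- Substituting n ≤ 2sw into M ≤ 4^(b+1) n gives M ≤ 4^b * 8w * s. A second 4^b absorbs 8w, which is
-- linear in b, and 4^b * 4^b = 2^(4b).
blocks-suffice : ∀ {b n s w M} → 8 * w ≤ 4 ^ᴺ b → n ≤ s * w + s * w → M ≤ 4 ^ᴺ suc b * n → M ≤ 2 ^ᴺ (4 * b) * s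
blocks-suffice {b} {n} {s} {w} {M} 8w≤ n≤ M≤ = begin
  M                                  ≤⟨ M≤ ⟩
  4 ^ᴺ suc b * n                      ≤⟨ *-monoʳ-≤ (4 ^ᴺ suc b) n≤ ⟩
  4 * 4 ^ᴺ b * (s * w + s * w)        ≡⟨ rearrange (4 ^ᴺ b) s w ⟩
  4 ^ᴺ b * (8 * w) * s                ≤⟨ *-monoˡ-≤ s (*-monoʳ-≤ (4 ^ᴺ b) 8w≤) ⟩
  4 ^ᴺ b * 4 ^ᴺ b * s                  ≡⟨ cong (_* s) (^-distribˡ-+-* 4 b b) ⟨
  4 ^ᴺ (b + b) * s                    ≡⟨ cong (_* s) (^-*-assoc 2 2 (b + b)) ⟩
  2 ^ᴺ (2 * (b + b)) * s              ≡⟨ cong (λ z → 2 ^ᴺ z * s) (exponent b) ⟩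
  2 ^ᴺ (4 * b) * s                    ∎
  where
  open ≤-Reasoning
  rearrange : ∀ p s w → 4 * p * (s * w + s * w) ≡ p * (8 * w) * s
  rearrange = solve-∀
  exponent : ∀ b → 2 * (b + b) ≡ 4 * b
  exponent = solve-∀

-- Abstract because unfolding products with such numerals on the left is infeasible.
abstract
  D Y : ℕ
  -- D + 1 has to reach 125² = 15625; a round value above it.
  D = 20000
  -- Half of 1000 * 9 * D, so that X * b is exactly 1000 times the average degree 9Db of the edge
  -- list.
  Y = 90000000

  instance
    D≢0 : NonZero D
    D≢0 = _
    Y≢0 : NonZero Y
    Y≢0 = _

  D-large : 125 * 125 * 1 ≤ suc D
  D-large = from-yes (125 * 125 * 1 ≤? suc D)

  Y-large : 1000 * (D * 9) ≤ Y + Y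
  Y-large = from-yes (1000 * (D * 9) ≤? Y + Y)

  Y-large′ : 100 * 12 * 4 ≤ Y + Y
  Y-large′ = from-yes (100 * 12 * 4 ≤? Y + Y)

X : ℕ
X = Y + Y

instance
  X≢0 : NonZero X
  X≢0 = double-nonZero Y

pair-exists : ∀ {b n Δ M} → 10 ≤ b → X * b ≤ Δ → Δ ≤ n → M ≤ 4 ^ᴺ suc b * n → Pair n Δ M
pair-exists {b} {n} {Δ} {M} 10≤b Xb≤Δ Δ≤n M≤ =
  let g , dense = dense-matrix (4 * b) (≤-trans 1≤b (m≤m+n b _))
      es , len , covers = hitting-edges g n D (D * (9 * b) * n) 0<n (counting-bound D b n (≤-trans (from-yes (3 ≤? 10)) 10≤b) 0<n)
  in Construction.result g 2≤k dense 0<t 0<s 100st≤n M≤ks D-large 0<d 1000d≤Δ Δ≤n es len covers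
  where
  open ≤-Reasoning
  1≤b : 1 ≤ b
  1≤b = ≤-trans (from-yes (1 ≤? 10)) 10≤b

  -- t is the 12 a of `dense-matrix` for a = 4b, as k = 2^(4b). With w = 100 t, blocks of s = n / w
  -- vertices satisfy 100 s t ≤ n: the s * t vertices that may fall into light blocks are at most n
  -- / 100.
  t w : ℕ
  t = 12 * (4 * b)
  w = 100 * t

  0<t : 0 < t
  0<t = *-mono-≤ {1} {12} (s≤s z≤n) (*-mono-≤ {1} {4} (s≤s z≤n) 1≤b)

  instance
    w≢0 : NonZero w
    w≢0 = >-nonZero (*-mono-≤ {1} {100} (s≤s z≤n) 0<t)

  s : ℕ
  s = n / w

  w≤n : w ≤ n
  w≤n = begin
    100 * (12 * (4 * b))   ≡⟨ trans (*-assoc (100 * 12) 4 b) (*-assoc 100 12 (4 * b)) ⟨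
    100 * 12 * 4 * b       ≤⟨ *-monoˡ-≤ b Y-large′ ⟩
    X * b                  ≤⟨ Xb≤Δ ⟩
    Δ                      ≤⟨ Δ≤n ⟩
    n                      ∎

  0<n : 0 < n
  0<n = ≤-trans (>-nonZero⁻¹ w) w≤n

  0<s : 0 < s
  0<s = m≥n⇒m/n>0 w≤n

  100st≤n : 100 * (s * t) ≤ n
  100st≤n = begin
    100 * (s * t)  ≡⟨ trans (sym (*-assoc 100 s t)) (trans (cong (_* t) (*-comm 100 s)) (*-assoc s 100 t)) ⟩
    s * w          ≤⟨ m/n*n≤m n w ⟩
    n              ∎

  n≤2sw : n ≤ s * w + s * w
  n≤2sw = begin
    n              ≡⟨ m≡m%n+[m/n]*n n w ⟩
    n % w + s * w  ≤⟨ +-monoˡ-≤ (s * w) (≤-trans (<⇒≤ (m%n<n n w)) (m≤n*m w s {{>-nonZero 0<s}})) ⟩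
    s * w + s * w  ∎

  -- 8w = 38400 b, and b = 10 is the first positive value with 38400 b ≤ 4^b. This is the origin of
  -- the 10 in Δ₀ = 10 X.
  8w≤4^b : 8 * w ≤ 4 ^ᴺ b
  8w≤4^b = begin
    8 * (100 * (12 * (4 * b)))  ≡⟨ trans (*-assoc (8 * 100 * 12) 4 b) (trans (*-assoc (8 * 100) 12 (4 * b)) (*-assoc 8 100 (12 * (4 * b)))) ⟨
    8 * 100 * 12 * 4 * b        ≤⟨ subst (λ z → 8 * 100 * 12 * 4 * z ≤ 4 ^ᴺ z) (m+[n∸m]≡n 10≤b)
                                     (linear-≤-4^ (8 * 100 * 12 * 4) 10 (b ∸ 10) (s≤s z≤n) (from-yes (8 * 100 * 12 * 4 * 10 ≤? 4 ^ᴺ 10))) ⟩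
    4 ^ᴺ b                      ∎

  M≤ks : M ≤ 2 ^ᴺ (4 * b) * s
  M≤ks = blocks-suffice {b} {n} {s} {w} 8w≤4^b n≤2sw M≤

  2≤k : 2 ≤ 2 ^ᴺ (4 * b)
  2≤k = ^-monoʳ-≤ 2 {1} (*-mono-≤ {1} {4} (s≤s z≤n) 1≤b)

  0<d : 0 < D * (9 * b)
  0<d = *-mono-≤ (>-nonZero⁻¹ D) (*-mono-≤ {1} {9} (s≤s z≤n) 1≤b)

  1000d≤Δ : 1000 * (D * (9 * b)) ≤ Δ
  1000d≤Δ = begin
    1000 * (D * (9 * b))   ≡⟨ trans (*-assoc 1000 (D * 9) b) (cong (1000 *_) (*-assoc D 9 b)) ⟨
    1000 * (D * 9) * b     ≤⟨ *-monoˡ-≤ b Y-large ⟩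
    X * b                  ≤⟨ Xb≤Δ ⟩
    Δ                      ∎

lemma3p4 : Σ[ c′ ∈ ℚ ] Σ[ Δ₀ ∈ ℕ ] (1ℚ ℚ.< c′ ×
    (∀ (Δ n : ℕ) → Δ₀ ≤ Δ → Δ ≤ n →
    Σ[ N ∈ ℕ ] Σ[ D₀ ∈ Digraph (Fin N) ] Σ[ A ∈ Subset N ] Σ[ B ∈ Subset N ]
    Σ[ M ∈ ℕ ] Σ[ R ∈ Digraph (Fin M) ]
    ( IsBipartiteFromTo D₀ A B
    × ∣ A ∣ ≡ ∣ B ∣
    × ∣ A ∣ ≤ n
    × maxDegree D₀ ≡ Δ
    × + M ≡ floor (c′ ^ Δ ℚ.* (+ n ℚ./ 1))
    × IsTournament R
    × (∀ (A′ B′ : Subset N) → A′ ⊆ A → B′ ⊆ B →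
    (98 * ∣ A ∣ ≤ 100 * ∣ A′ ∣ → 98 * ∣ A ∣ ≤ 100 * ∣ B′ ∣ →
    ¬ Copy (D₀ [ A′ ∪ B′ ]) R)
    × (∣ A ∣ ≤ 100 * ∣ A′ ∣ → ∣ A ∣ ≤ 100 * ∣ B′ ∣ →
    0 < edgeCount D₀ A′ B′)))))
lemma3p4 = + suc X ℚ./ X , 10 * X , 1<ratio X , λ Δ n 10X≤Δ Δ≤n →
  let M , M≡ , M≤ = floor-ratio-^ (suc X) X Δ n
      N , D₀ , A , B , R , bipartite , ∣A∣≡∣B∣ , ∣A∣≤n , degree≡Δ , tournament , avoids =
        -- b = Δ / X is rounded down so that X * b ≤ Δ, as the degree bound requires. The growth of
        -- c′^Δ is then measured by Δ ≤ X * (b + 1), whence 4^(b+1).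
        pair-exists {Δ / X} (10≤Δ/X Δ 10X≤Δ) (X*[Δ/X]≤Δ Δ) Δ≤n (M≤4^[b+1]n Δ n M M≤)
  in N , D₀ , A , B , M , R , bipartite , ∣A∣≡∣B∣ , ∣A∣≤n , degree≡Δ , M≡ , tournament , avoids
  where
  10≤Δ/X : ∀ Δ → 10 * X ≤ Δ → 10 ≤ Δ / X
  10≤Δ/X Δ le = subst (_≤ Δ / X) (m*n/n≡m 10 X) (/-monoˡ-≤ X le)

  X*[Δ/X]≤Δ : ∀ Δ → X * (Δ / X) ≤ Δ
  X*[Δ/X]≤Δ Δ = subst (_≤ Δ) (*-comm (Δ / X) X) (m/n*n≤m Δ X)

  M≤4^[b+1]n : ∀ Δ n M → M * X ^ᴺ Δ ≤ suc X ^ᴺ Δ * n → M ≤ 4 ^ᴺ suc (Δ / X) * n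
  M≤4^[b+1]n Δ n M le = *-cancelʳ-≤ _ _ (X ^ᴺ Δ) {{m^n≢0 X Δ}} (begin
    M * X ^ᴺ Δ                        ≤⟨ le ⟩
    suc X ^ᴺ Δ * n                    ≤⟨ *-monoˡ-≤ n (growth Y Δ (suc (Δ / X)) Δ≤) ⟩
    4 ^ᴺ suc (Δ / X) * X ^ᴺ Δ * n     ≡⟨ swap (4 ^ᴺ suc (Δ / X)) (X ^ᴺ Δ) n ⟩
    4 ^ᴺ suc (Δ / X) * n * X ^ᴺ Δ     ∎)
    where
    open ≤-Reasoning
    swap : ∀ x y z → x * y * z ≡ x * z * y
    swap = solve-∀
    Δ≤ : Δ ≤ X * suc (Δ / X)
    Δ≤ = begin
      Δ                    ≡⟨ m≡m%n+[m/n]*n Δ X ⟩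
      Δ % X + Δ / X * X    ≤⟨ +-monoˡ-≤ (Δ / X * X) (<⇒≤ (m%n<n Δ X)) ⟩
      X + Δ / X * X        ≡⟨ trans (*-suc X (Δ / X)) (cong (λ z → X + z) (*-comm X (Δ / X))) ⟨
      X * suc (Δ / X)      ∎
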